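{- Let $G$ be a finite simple graph and $\theta$ a real number. Then $G$ and $S_\theta(G)$ have the same Gallai-Edmonds decomposition with respect to $\theta$.
   Context: For a graph $G$, $\mu(G,x)=\sum_{r\ge 0}(-1)^r p(G,r)x^{|V(G)|-2r}$ is the matching polynomial, where $p(G,r)$ is the number of $r$-matchings ($p(G,0)=1$; the empty graph has $\mu=1$), and $\textnormal{mult}(\theta,G)$ is the multiplicity of $\theta$ as a root of $\mu(G,x)$ ($0$ if not a root). $G\setminus X$ denotes deletion of the vertex set $X$. A vertex $u$ is $\theta$-essential if $\textnormal{mult}(\theta,G\setminus u)=\textnormal{mult}(\theta,G)-1$; it is $\theta$-special if it is not $\theta$-essential but is adjacent to some $\theta$-essential vertex. $A_\theta(G)$ is the set of $\theta$-special vertices of $G$. The graph $S_\theta(G)$ has vertex set $V(G)$, and distinct $w,z$ are adjacent in $S_\theta(G)$ iff $wz\in E(G)$ or one of $w,z$ lies in $A_\theta(G)$ (i.e. every $\theta$-special vertex is joined to all other vertices). Two graphs $G,G'$ have the same Gallai-Edmonds decomposition with respect to $\theta$ if there is a bijection $\psi:V(G)\to V(G')$ with $\psi(A_\theta(G))=A_\theta(G')$ whose restriction to $V(G)\setminus A_\theta(G)$ is a graph isomorphism from $G\setminus A_\theta(G)$ onto $G'\setminus A_\theta(G')$. -}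

module Defs where

open import Level using (0ℓ)
open import Data.Bool using (Bool; true; false; _∧_; _∨_; if_then_else_; not)
open import Data.Nat as ℕ using (ℕ; zero; suc; _∸_; _≤ᵇ_; _≡ᵇ_)
open import Data.Integer as ℤ using (ℤ; +_; -[1+_])
open import Data.Fin using (Fin; toℕ)
open import Data.Fin.Properties using (_≟_)
open import Data.Fin.Subset using (Subset; ∁; ∣_∣; ⊤)
open import Data.Vec using (lookup)
open import Data.List using (List; []; _∷_; _++_; map; filterᵇ; length; concatMap; foldr; replicate; upTo)
open import Data.List.Base using (allFin)
open import Data.Product using (_×_; _,_; Σ; ∃; ∃-syntax)
open import Relation.Nullary using (¬_; does)
import Relation.Nullary
import Data.Empty
import Data.Fin.Subset
open import Relation.Binary using (Rel; IsTotalOrder)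
open import Relation.Binary.PropositionalEquality using (_≡_; refl; sym; cong)
open import Function.Bundles using (_⤖_; _⇔_; Bijection)
open import Algebra.Core using (Op₁; Op₂)
open import Algebra.Structures using (IsCommutativeRing)

-- The real numbers, axiomatised as a Dedekind-complete ordered field
-- (the standard library has no real numbers; any model of this record
-- is isomorphic to ℝ, classically).

record RealField : Set₁ where
  infixl 6 _+_
  infixl 7 _*_
  infix 4 _≈_ _≤_
  field
    Carrier : Set
    _≈_ : Rel Carrier 0ℓ
    _+_ _*_ : Op₂ Carrier
    -_ : Op₁ Carrier
    0# 1# : Carrier
    isCommutativeRing : IsCommutativeRing _≈_ _+_ _*_ -_ 0# 1#
    0≉1 : ¬ (0# ≈ 1#)
    inverse : ∀ x → ¬ (x ≈ 0#) → ∃[ y ] (x * y ≈ 1#)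
    _≤_ : Rel Carrier 0ℓ
    isTotalOrder : IsTotalOrder _≈_ _≤_
    +-mono-≤ : ∀ {x y} z → x ≤ y → x + z ≤ y + z
    *-nonneg : ∀ {x y} → 0# ≤ x → 0# ≤ y → 0# ≤ x * y
    sup : ∀ (P : Carrier → Set) → ∃ P → (∃[ b ] (∀ x → P x → x ≤ b)) →
          ∃[ s ] ((∀ x → P x → x ≤ s) × (∀ b → (∀ x → P x → x ≤ b) → s ≤ b))

record Graph (n : ℕ) : Set where
  field
    adj    : Fin n → Fin n → Bool
    adj-sym : ∀ u v → adj u v ≡ adj v u
    irrefl : ∀ u → adj u u ≡ false
open Graph public

Adjacent : ∀ {n} → Graph n → Fin n → Fin n → Set
Adjacent G u v = adj G u v ≡ true

pairs : (n : ℕ) → List (Fin n × Fin n)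
pairs n = concatMap (λ i → concatMap (λ j → if suc (toℕ i) ≤ᵇ toℕ j then (i , j) ∷ [] else [])
                                       (allFin n)) (allFin n)

sublists : {A : Set} → List A → List (List A)
sublists [] = [] ∷ []
sublists (x ∷ xs) = sublists xs ++ map (x ∷_) (sublists xs)

eqᵇ : ∀ {n} → Fin n → Fin n → Bool
eqᵇ u v = does (u ≟ v)

disjointᵇ : ∀ {n} → Fin n × Fin n → Fin n × Fin n → Bool
disjointᵇ (a , b) (c , d) = not (eqᵇ a c ∨ eqᵇ a d ∨ eqᵇ b c ∨ eqᵇ b d)

allᵇ : {A : Set} → (A → Bool) → List A → Bool
allᵇ p [] = true
allᵇ p (x ∷ xs) = p x ∧ allᵇ p xs

pairwiseDisjointᵇ : ∀ {n} → List (Fin n × Fin n) → Bool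
pairwiseDisjointᵇ [] = true
pairwiseDisjointᵇ (e ∷ es) = allᵇ (disjointᵇ e) es ∧ pairwiseDisjointᵇ es

isMatchingᵇ : ∀ {n} → Graph n → Subset n → List (Fin n × Fin n) → Bool
isMatchingᵇ G U M =
  allᵇ (λ { (i , j) → adj G i j ∧ lookup U i ∧ lookup U j }) M ∧ pairwiseDisjointᵇ M

numMatchings : ∀ {n} → Graph n → Subset n → ℕ → ℕ
numMatchings {n} G U r =
  length (filterᵇ (λ M → isMatchingᵇ G U M ∧ (length M ≡ᵇ r)) (sublists (pairs n)))

-- Polynomials over a real field, as coefficient lists (constant term first)

module Poly (ℝ : RealField) where
  open RealField ℝ

  P : Set
  P = List Carrier

  coeff : P → ℕ → Carrier
  coeff [] k = 0#
  coeff (a ∷ p) zero = a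
  coeff (a ∷ p) (suc k) = coeff p k

  _≈ₚ_ : P → P → Set
  p ≈ₚ q = ∀ k → coeff p k ≈ coeff q k

  _+ₚ_ : P → P → P
  [] +ₚ q = q
  (a ∷ p) +ₚ [] = a ∷ p
  (a ∷ p) +ₚ (b ∷ q) = (a + b) ∷ (p +ₚ q)

  _*ₚ_ : P → P → P
  [] *ₚ q = []
  (a ∷ p) *ₚ q = map (a *_) q +ₚ (0# ∷ (p *ₚ q))

  _^ₚ_ : P → ℕ → P
  p ^ₚ zero = 1# ∷ []
  p ^ₚ suc k = p *ₚ (p ^ₚ k)

  eval : P → Carrier → Carrier
  eval [] x = 0#
  eval (a ∷ p) x = a + x * eval p x

  X-_ : Carrier → P
  X- θ = (- θ) ∷ 1# ∷ []

  IsMult : Carrier → P → ℕ → Set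
  IsMult θ p k = Σ P λ q → (p ≈ₚ (((X- θ) ^ₚ k) *ₚ q)) × ¬ (eval q θ ≈ 0#)

  fromℕ : ℕ → Carrier
  fromℕ zero = 0#
  fromℕ (suc n) = 1# + fromℕ n

  fromℤ : ℤ → Carrier
  fromℤ (+ n) = fromℕ n
  fromℤ -[1+ n ] = - fromℕ (suc n)

  monomial : Carrier → ℕ → P
  monomial c k = replicate k 0# ++ (c ∷ [])

  sign : ℕ → Carrier
  sign zero = 1#
  sign (suc r) = - sign r

  μ[_,_] : ∀ {n} → Graph n → Subset n → P
  μ[_,_] G U = foldr _+ₚ_ []
    (map (λ r → if (r ℕ.+ r) ≤ᵇ m then monomial (sign r * fromℕ (numMatchings G U r)) (m ∸ (r ℕ.+ r)) else [])
         (upTo (suc m)))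
    where m = ∣ U ∣

  μ∖ : ∀ {n} → Graph n → Subset n → P
  μ∖ G X = μ[ G , ∁ X ]

  μ : ∀ {n} → Graph n → P
  μ {n} G = μ[ G , ⊤ ]

module GE (ℝ : RealField) where
  open RealField ℝ
  open Poly ℝ public

  ⁅_⁆ᵥ : ∀ {n} → Fin n → Subset n
  ⁅ u ⁆ᵥ = Data.Fin.Subset.⁅ u ⁆

  Essential : (θ : Carrier) → ∀ {n} → Graph n → Fin n → Set
  Essential θ G u = ∃[ k ] (IsMult θ (μ G) (suc k) × IsMult θ (μ∖ G ⁅ u ⁆ᵥ) k)

  Special : (θ : Carrier) → ∀ {n} → Graph n → Fin n → Set
  Special θ G u = ¬ Essential θ G u × ∃[ w ] (Adjacent G u w × Essential θ G w)

  -- S_θ(G), given the (finite) set A = A_θ(G) as a subset of vertices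
  S-graph : ∀ {n} → Graph n → Subset n → Graph n
  S-graph {n} G A = record { adj = a ; adj-sym = s ; irrefl = i }
    where
      a : Fin n → Fin n → Bool
      a u v = not (eqᵇ u v) ∧ (adj G u v ∨ lookup A u ∨ lookup A v)
      eq-sym : ∀ (u v : Fin n) → eqᵇ u v ≡ eqᵇ v u
      eq-sym u v with u ≟ v | v ≟ u
      ... | Relation.Nullary.yes _ | Relation.Nullary.yes _ = refl
      ... | Relation.Nullary.no _ | Relation.Nullary.no _ = refl
      ... | Relation.Nullary.yes p | Relation.Nullary.no q = Data.Empty.⊥-elim (q (sym p))
      ... | Relation.Nullary.no q | Relation.Nullary.yes p = Data.Empty.⊥-elim (q (sym p))
      ∨-comm : ∀ x y → (x ∨ y) ≡ (y ∨ x)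
      ∨-comm false false = refl
      ∨-comm false true = refl
      ∨-comm true false = refl
      ∨-comm true true = refl
      s : ∀ u v → a u v ≡ a v u
      s u v rewrite eq-sym u v | Graph.adj-sym G u v | ∨-comm (lookup A u) (lookup A v) = refl
      i : ∀ u → a u u ≡ false
      i u with u ≟ u
      ... | Relation.Nullary.yes _ = refl
      ... | Relation.Nullary.no ¬p = Data.Empty.⊥-elim (¬p refl)

  SameGE : (θ : Carrier) → ∀ {n n'} → Graph n → Graph n' → Set
  SameGE θ {n} {n'} G G' =
    Σ (Fin n ⤖ Fin n') λ ψ →
      let f = Bijection.to ψ in
      (∀ v → Special θ G v ⇔ Special θ G' (f v)) ×
      (∀ u v → ¬ Special θ G u → ¬ Special θ G v → adj G u v ≡ adj G' (f u) (f v))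

{-# OPTIONS --safe #-}
module Submission where

-- Write μ(U) for the matching polynomial of G[U], expanded as a power series at θ. The expansion
-- μ(U) = x_v μ(U∖v) − Σ_{w∼v} μ(U∖v∖w), valid for arbitrary vertex weights x, gives the recursion
--   Δ(U;u,v) := μ(U∖u)μ(U∖v) − μ(U)μ(U∖u∖v) = Σ_{w∼u, w≠v} Δ(U∖u;w,v) + [u∼v] μ(U∖u∖v)²,
-- so Δ is a sum of squares: its order at θ is even and its leading coefficient is positive.
-- Since μ(U)′ = Σ_v μ(U∖v), the Wronskian of μ(U) and μ(U∖v) is μ(U∖v)² plus such Δ's. Hence deleting
-- a vertex changes the multiplicity by at most one, and the leading coefficients at θ of μ(U) and
-- μ(U∖v) have the same sign when v is essential. So a raises the multiplicity of U exactly
-- when a has a neighbour that is essential in U∖a: no cancellation occurs in the expansion at a.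
-- Parity of the order of Δ shows that a special vertex a raises the multiplicity. Perturbing a single
-- weight x_v in Δ ≥ 0 shows that "deleting both lowers the multiplicity by at most one" is transitive
-- on essential vertices (Gallai's lemma), from which U and U∖a have the same essential vertices.
-- Deleting all special vertices of G thus keeps the essential vertices and leaves a graph of multiplicity
-- greater than their number; adding them back one at a time, each joined to everything, reverses
-- every step as long as the multiplicity stays positive.

open import Defs
open import Data.Nat using (ℕ)
open import Data.Fin using (Fin)
open import Data.Fin.Subset using (Subset; _∈_)
open import Function.Bundles using (_⇔_)

open import Level using (0ℓ)
open import Algebra.Bundles using (CommutativeRing)
open import Data.Bool using (Bool; true; false; _∧_; _∨_; not; if_then_else_)
import Data.Bool.Properties as Bool
open import Data.Bool.Solver using (module ∨-∧-Solver)
open import Data.Empty using (⊥; ⊥-elim)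
open import Data.Fin using (zero; suc; toℕ)
open import Data.Fin.Properties using (_≟_; any?; toℕ-injective)
open import Data.Fin.Subset using (∣_∣; ⊤; ∁; ⁅_⁆)
open import Data.Integer as ℤ using (ℤ; +_; -[1+_])
import Data.Integer.Properties as ℤ
open import Data.List as List using (List; []; _∷_; _++_; allFin; applyUpTo; concatMap; filterᵇ; length)
open import Data.List.Membership.Propositional using () renaming (_∈_ to _∈ˡ_)
open import Data.List.Membership.Propositional.Properties using (∈-allFin)
open import Data.List.Relation.Unary.Any using (here; there)
open import Data.Maybe using (just; nothing)
open import Data.Nat as ℕ using (zero; suc; s≤s; z≤n; _≤ᵇ_; _<ᵇ_; _≡ᵇ_; _∸_)
import Data.Nat.Properties as ℕ
open import Data.Product using (_×_; _,_; proj₁; proj₂; ∃-syntax)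
open import Data.Sum using (_⊎_; inj₁; inj₂)
open import Data.Vec using ([]; _∷_; lookup; _[_]≔_)
import Data.Vec.Properties as Vec
open import Function using (_∘_; id)
open import Function.Bundles using (mk⇔; Equivalence)
open import Function.Construct.Identity using (⤖-id)
open import Relation.Binary using (IsTotalOrder; tri<; tri≈; tri>)
open import Relation.Binary.Definitions using (WeaklyDecidable)
open import Relation.Binary.PropositionalEquality as ≡ using (_≡_; _≢_)
open import Relation.Nullary using (¬_; Dec; yes; no)
open import Relation.Nullary.Decidable using (dec-true; dec-false)

-- A ring solver with integer coefficients over any commutative ring.

module IntegerCoefficientSolver {c ℓ} (R : CommutativeRing c ℓ) where
  open import Algebra.Solver.Ring.AlmostCommutativeRing using (fromCommutativeRing; _-Raw-AlmostCommutative⟶_; Induced-equivalence)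
  open CommutativeRing R hiding (zero)
  open import Algebra.Properties.Ring ring
  open import Algebra.Properties.AbelianGroup +-abelianGroup using (⁻¹-∙-comm)
  open import Algebra.Properties.Semiring.Mult semiring using (×-homo-+; ×1-homo-*) renaming (_×_ to infixr 8 _·_)
  open import Relation.Binary.Reasoning.Setoid setoid

  ⟦_⟧ℤ : ℤ → Carrier
  ⟦ + n ⟧ℤ = n · 1#
  ⟦ -[1+ n ] ⟧ℤ = - (suc n · 1#)

  ⊖-homo : ∀ m n → ⟦ m ℤ.⊖ n ⟧ℤ ≈ m · 1# - n · 1#
  ⊖-homo m zero = sym (trans (+-congˡ -0#≈0#) (+-identityʳ _))
  ⊖-homo zero (suc n) = sym (+-identityˡ _)
  ⊖-homo (suc m) (suc n) = begin
    ⟦ suc m ℤ.⊖ suc n ⟧ℤ                 ≡⟨ ≡.cong ⟦_⟧ℤ (ℤ.[1+m]⊖[1+n]≡m⊖n m n) ⟩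
    ⟦ m ℤ.⊖ n ⟧ℤ                         ≈⟨ ⊖-homo m n ⟩
    m · 1# - n · 1#                      ≈⟨ +-congʳ (trans (+-congʳ (-‿inverseˡ 1#)) (+-identityˡ _)) ⟨
    (- 1# + 1# + m · 1#) - n · 1#        ≈⟨ +-congʳ (trans (+-assoc _ _ _) (+-comm _ _)) ⟩
    (1# + m · 1# + - 1#) - n · 1#        ≈⟨ +-assoc _ _ _ ⟩
    1# + m · 1# + (- 1# - n · 1#)        ≈⟨ +-congˡ (⁻¹-∙-comm _ _) ⟩
    suc m · 1# - suc n · 1#              ∎

  +-homoℤ : ∀ i j → ⟦ i ℤ.+ j ⟧ℤ ≈ ⟦ i ⟧ℤ + ⟦ j ⟧ℤ
  +-homoℤ (+ m) (+ n) = ×-homo-+ 1# m n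
  +-homoℤ (+ m) -[1+ n ] = ⊖-homo m (suc n)
  +-homoℤ -[1+ m ] (+ n) = trans (⊖-homo n (suc m)) (+-comm _ _)
  +-homoℤ -[1+ m ] -[1+ n ] = begin
    - (suc (suc (m ℕ.+ n)) · 1#)      ≡⟨ ≡.cong (λ k → - (k · 1#)) (≡.cong suc (ℕ.+-suc m n)) ⟨
    - ((suc m ℕ.+ suc n) · 1#)        ≈⟨ -‿cong (×-homo-+ 1# (suc m) (suc n)) ⟩
    - (suc m · 1# + suc n · 1#)       ≈⟨ ⁻¹-∙-comm _ _ ⟨
    - (suc m · 1#) - suc n · 1#       ∎

  -‿homoℤ : ∀ i → ⟦ ℤ.- i ⟧ℤ ≈ - ⟦ i ⟧ℤ
  -‿homoℤ (+ zero) = sym -0#≈0#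
  -‿homoℤ (+ suc n) = refl
  -‿homoℤ -[1+ n ] = sym (-‿involutive _)

  *-homo⁺ : ∀ m j → ⟦ + m ℤ.* j ⟧ℤ ≈ m · 1# * ⟦ j ⟧ℤ
  *-homo⁺ m (+ n) = begin
    ⟦ + m ℤ.* + n ⟧ℤ  ≡⟨ ≡.cong ⟦_⟧ℤ (ℤ.pos-* m n) ⟨
    (m ℕ.* n) · 1#    ≈⟨ ×1-homo-* m n ⟩
    m · 1# * n · 1#   ∎
  *-homo⁺ m -[1+ n ] = begin
    ⟦ + m ℤ.* ℤ.- + suc n ⟧ℤ     ≡⟨ ≡.cong ⟦_⟧ℤ (ℤ.neg-distribʳ-* (+ m) (+ suc n)) ⟨
    ⟦ ℤ.- (+ m ℤ.* + suc n) ⟧ℤ   ≈⟨ -‿homoℤ (+ m ℤ.* + suc n) ⟩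
    - ⟦ + m ℤ.* + suc n ⟧ℤ       ≈⟨ -‿cong (*-homo⁺ m (+ suc n)) ⟩
    - (m · 1# * suc n · 1#)      ≈⟨ -‿distribʳ-* _ _ ⟩
    m · 1# * - (suc n · 1#)      ∎

  *-homoℤ : ∀ i j → ⟦ i ℤ.* j ⟧ℤ ≈ ⟦ i ⟧ℤ * ⟦ j ⟧ℤ
  *-homoℤ (+ m) j = *-homo⁺ m j
  *-homoℤ -[1+ m ] j = begin
    ⟦ ℤ.- + suc m ℤ.* j ⟧ℤ       ≡⟨ ≡.cong ⟦_⟧ℤ (ℤ.neg-distribˡ-* (+ suc m) j) ⟨
    ⟦ ℤ.- (+ suc m ℤ.* j) ⟧ℤ     ≈⟨ -‿homoℤ (+ suc m ℤ.* j) ⟩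
    - ⟦ + suc m ℤ.* j ⟧ℤ         ≈⟨ -‿cong (*-homo⁺ (suc m) j) ⟩
    - (suc m · 1# * ⟦ j ⟧ℤ)      ≈⟨ -‿distribˡ-* _ _ ⟩
    - (suc m · 1#) * ⟦ j ⟧ℤ      ∎

  morphism : ℤ.+-*-rawRing -Raw-AlmostCommutative⟶ fromCommutativeRing R
  morphism = record
    { ⟦_⟧ = ⟦_⟧ℤ ; +-homo = +-homoℤ ; *-homo = *-homoℤ ; -‿homo = -‿homoℤ
    ; 0-homo = refl ; 1-homo = +-identityʳ 1# }

  _coeff≟_ : WeaklyDecidable (Induced-equivalence morphism)
  i coeff≟ j with i ℤ.≟ j
  ... | yes ≡.refl = just refl
  ... | no _ = nothing

  open import Algebra.Solver.Ring ℤ.+-*-rawRing (fromCommutativeRing R) morphism _coeff≟_ public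
    using (Polynomial; solve; _:=_; _:+_; _:*_; _:-_; :-_; con)

  :0 : ∀ {n} → Polynomial n
  :0 = con (+ 0)

-- Order, decidability and cancellation in the real field.

module OrderedField (ℝ : RealField) where
  open RealField ℝ hiding (isCommutativeRing; isTotalOrder)
  open IsTotalOrder (RealField.isTotalOrder ℝ) public
    using (total; antisym; ≤-respˡ-≈; ≤-respʳ-≈)
    renaming (refl to ≤-refl; trans to ≤-trans; reflexive to ≤-reflexive)

  commutativeRing : CommutativeRing 0ℓ 0ℓ
  commutativeRing = record { isCommutativeRing = RealField.isCommutativeRing ℝ }

  open CommutativeRing commutativeRing public
    hiding (Carrier; _≈_; _+_; _*_; -_; 0#; 1#; zero)
  open import Algebra.Properties.Ring ring public
    using (-0#≈0#; -‿distribˡ-*; -‿distribʳ-*; -‿involutive)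
  open IntegerCoefficientSolver commutativeRing
  open import Algebra.Properties.Semiring.Mult semiring public
    using () renaming (_×_ to infixr 8 _·_)

  +-mono : ∀ {a b c d} → a ≤ b → c ≤ d → a + c ≤ b + d
  +-mono {a} {b} {c} {d} a≤b c≤d =
    ≤-trans (+-mono-≤ c a≤b)
      (≤-respˡ-≈ (+-comm c b) (≤-respʳ-≈ (+-comm d b) (+-mono-≤ b c≤d)))

  0≤-+ : ∀ {a b} → 0# ≤ a → 0# ≤ b → 0# ≤ a + b
  0≤-+ p q = ≤-respˡ-≈ (+-identityˡ 0#) (+-mono p q)

  ≤⇒0≤- : ∀ {a b} → a ≤ b → 0# ≤ b - a
  ≤⇒0≤- {a} a≤b = ≤-respˡ-≈ (-‿inverseʳ a) (+-mono-≤ (- a) a≤b)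

  0≤-⇒≤ : ∀ {a b} → 0# ≤ b - a → a ≤ b
  0≤-⇒≤ {a} {b} p = ≤-respˡ-≈ (+-identityˡ a)
    (≤-respʳ-≈ (solve 2 (λ a b → b :- a :+ a := b) refl a b) (+-mono-≤ a p))

  neg-anti : ∀ {a b} → a ≤ b → - b ≤ - a
  neg-anti {a} {b} p = 0≤-⇒≤
    (≤-respʳ-≈ (solve 2 (λ a b → b :- a := (:- a) :- (:- b)) refl a b) (≤⇒0≤- p))

  a+a≤a⇒a≤0 : ∀ {a} → a + a ≤ a → a ≤ 0#
  a+a≤a⇒a≤0 {a} p = ≤-respˡ-≈ (solve 1 (λ a → a :+ a :- a := a) refl a)
    (≤-respʳ-≈ (-‿inverseʳ a) (+-mono-≤ (- a) p))

  0≤a² : ∀ a → 0# ≤ a * a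
  0≤a² a with total 0# a
  ... | inj₁ p = *-nonneg p p
  ... | inj₂ p = ≤-respʳ-≈ (solve 1 (λ a → (:- a) :* (:- a) := a :* a) refl a)
                   (*-nonneg 0≤-a 0≤-a)
    where 0≤-a = ≤-respˡ-≈ -0#≈0# (neg-anti p)

  0≤1 : 0# ≤ 1#
  0≤1 = ≤-respʳ-≈ (*-identityˡ 1#) (0≤a² 1#)

  1≰0 : ¬ (1# ≤ 0#)
  1≰0 p = 0≉1 (antisym 0≤1 p)

  -- The supremum of {0} ∪ {1 | Q} lies below or above 1/2.
  ¬Q⊎¬¬Q : (Q : Set) → ¬ Q ⊎ ¬ ¬ Q
  ¬Q⊎¬¬Q Q with sup (λ x → x ≈ 0# ⊎ (x ≈ 1# × Q)) (0# , inj₁ refl)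
                  (1# , λ { x (inj₁ e) → ≤-respˡ-≈ (sym e) 0≤1 ; x (inj₂ (e , _)) → ≤-reflexive e })
  ... | s , ub , least with total (s + s) 1#
  ...   | inj₁ 2s≤1 = inj₁ λ q → 1≰0 (a+a≤a⇒a≤0 (≤-trans (+-mono (1≤s q) (1≤s q)) 2s≤1))
    where 1≤s = λ q → ub 1# (inj₂ (refl , q))
  ...   | inj₂ 1≤2s = inj₂ λ ¬q → 1≰0 (≤-trans 1≤2s (≤-respʳ-≈ (+-identityˡ 0#) (+-mono (s≤0 ¬q) (s≤0 ¬q))))
    where s≤0 = λ ¬q → least 0# λ { x (inj₁ e) → ≤-reflexive e ; x (inj₂ (_ , q)) → ⊥-elim (¬q q) }

  2≉0 : ¬ (1# + 1# ≈ 0#)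
  2≉0 e = 1≰0 (≤-trans (≤-respˡ-≈ (+-identityˡ 1#) (+-mono 0≤1 ≤-refl)) (≤-reflexive e))

  halve : ∀ a → ∃[ h ] (h + h ≈ a)
  halve a with inverse (1# + 1#) 2≉0
  ... | i , 2i≈1 = i * a , (begin
    i * a + i * a                  ≈⟨ +-cong (*-identityˡ _) (*-identityˡ _) ⟨
    1# * (i * a) + 1# * (i * a)    ≈⟨ solve 3 (λ o i a → o :* (i :* a) :+ o :* (i :* a) := (o :+ o) :* i :* a) refl 1# i a ⟩
    (1# + 1#) * i * a              ≈⟨ *-congʳ 2i≈1 ⟩
    1# * a                         ≈⟨ *-identityˡ a ⟩
    a                              ∎)
    where open import Relation.Binary.Reasoning.Setoid setoid

  -- {z | ¬ ¬ z ≈ 0} is closed under doubling, so its supremum, which belongs to it, is 0.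
  ≈0-stable : ∀ {z} → ¬ ¬ (z ≈ 0#) → z ≈ 0#
  ≈0-stable {z} ¬¬z≈0 with sup (λ x → ¬ ¬ (x ≈ 0#)) (0# , λ k → k refl) (1# , ≤1)
    where
    ≤1 : ∀ x → ¬ ¬ (x ≈ 0#) → x ≤ 1#
    ≤1 x p with total x 1#
    ... | inj₁ q = q
    ... | inj₂ q = ⊥-elim (p λ e → 1≰0 (≤-respʳ-≈ e q))
  ... | s , ub , least = antisym (below ¬¬z≈0)
          (≤-respˡ-≈ -0#≈0# (≤-respʳ-≈ (-‿involutive z)
            (neg-anti (below λ k → ¬¬z≈0 λ e → k (trans (-‿cong e) -0#≈0#)))))
    where
    0≤s : 0# ≤ s
    0≤s = ub 0# λ k → k refl
    ¬¬s≈0 : ¬ ¬ (s ≈ 0#)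
    ¬¬s≈0 s≉0 = s≉0 (antisym s≤0 0≤s)
      where
      h = proj₁ (halve s)
      h+h≈s = proj₂ (halve s)
      2h≤0 : h ≤ 0# → s ≤ 0#
      2h≤0 p = ≤-respˡ-≈ h+h≈s (≤-respʳ-≈ (+-identityˡ 0#) (+-mono p p))
      ≤h : ∀ x → ¬ ¬ (x ≈ 0#) → x ≤ h
      ≤h x p with total x h
      ... | inj₁ q = q
      ... | inj₂ q = ⊥-elim (p λ e → s≉0 (antisym (2h≤0 (≤-respʳ-≈ e q)) 0≤s))
      s≤0 : s ≤ 0#
      s≤0 = 2h≤0 (a+a≤a⇒a≤0 (≤-respˡ-≈ (sym h+h≈s) (least h ≤h)))
    s≤0 : s ≤ 0#
    s≤0 = a+a≤a⇒a≤0 (ub (s + s) λ k → ¬¬s≈0 λ e → k (trans (+-cong e e) (+-identityˡ 0#)))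
    below : ∀ {x} → ¬ ¬ (x ≈ 0#) → x ≤ 0#
    below {x} p = ≤-trans (ub x p) s≤0

  -- Weak excluded middle for `x ≈ 0#` and its stability under double negation, both consequences of
  -- completeness, combine to a decision. It makes lowest nonzero coefficients computable.
  _≈0? : ∀ x → Dec (x ≈ 0#)
  x ≈0? with ¬Q⊎¬¬Q (x ≈ 0#)
  ... | inj₁ p = no p
  ... | inj₂ p = yes (≈0-stable p)

  integral : ∀ {a b} → ¬ (a ≈ 0#) → a * b ≈ 0# → b ≈ 0#
  integral {a} {b} a≉0 ab≈0 with inverse a a≉0
  ... | i , ai≈1 = trans (sym (*-identityˡ b)) (trans (*-congʳ (sym ai≈1))
        (trans (solve 3 (λ a b i → a :* i :* b := i :* (a :* b)) refl a b i) (trans (*-congˡ ab≈0) (zeroʳ i))))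

  *-≉0 : ∀ {a b} → ¬ (a ≈ 0#) → ¬ (b ≈ 0#) → ¬ (a * b ≈ 0#)
  *-≉0 a≉0 b≉0 ab≈0 = b≉0 (integral a≉0 ab≈0)

  a²≈0⇒a≈0 : ∀ {a} → a * a ≈ 0# → a ≈ 0#
  a²≈0⇒a≈0 {a} e with a ≈0?
  ... | yes p = p
  ... | no ¬p = integral ¬p e

  0≤∧0≤∧+≈0⇒≈0 : ∀ {a b} → 0# ≤ a → 0# ≤ b → a + b ≈ 0# → a ≈ 0# × b ≈ 0#
  0≤∧0≤∧+≈0⇒≈0 {a} {b} 0≤a 0≤b e =
    antisym (≤-respʳ-≈ e (≤-respˡ-≈ (+-identityʳ a) (+-mono ≤-refl 0≤b))) 0≤a ,
    antisym (≤-respʳ-≈ e (≤-respˡ-≈ (+-identityˡ b) (+-mono 0≤a ≤-refl))) 0≤b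

  1≤suc·1 : ∀ n → 1# ≤ suc n · 1#
  1≤suc·1 zero = ≤-reflexive (sym (+-identityʳ 1#))
  1≤suc·1 (suc n) = ≤-respˡ-≈ (+-identityʳ 1#) (+-mono ≤-refl (≤-trans 0≤1 (1≤suc·1 n)))

  suc·1≉0 : ∀ n → ¬ (suc n · 1# ≈ 0#)
  suc·1≉0 n e = 1≰0 (≤-trans (1≤suc·1 n) (≤-reflexive e))

-- Formal power series: products, orders, local nonnegativity, derivatives.

module PowerSeries (ℝ : RealField) where
  open RealField ℝ using (Carrier; _≈_; _+_; _*_; -_; 0#; 1#; _≤_)
  open OrderedField ℝ
  open IntegerCoefficientSolver commutativeRing
  open import Relation.Binary.Reasoning.Setoid setoid
  import Algebra.Construct.Pointwise as Pointwise

  Series : Set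
  Series = ℕ → Carrier

  infix 4 _≋_
  _≋_ : Series → Series → Set
  s ≋ t = ∀ k → s k ≈ t k

  tail : Series → Series
  tail s k = s (suc k)

  scale : Carrier → Series → Series
  scale c s k = c * s k

  infixl 6 _⊞_
  _⊞_ : Series → Series → Series
  (s ⊞ t) k = s k + t k

  infixl 7 _⊛_
  _⊛_ : Series → Series → Series
  (s ⊛ t) zero = s 0 * t 0
  (s ⊛ t) (suc k) = s 0 * t (suc k) + (tail s ⊛ t) k

  const : Carrier → Series
  const c zero = c
  const c (suc k) = 0#

  0ₛ : Series
  0ₛ _ = 0#

  ⊛-cong : ∀ {s s′ t t′} → s ≋ s′ → t ≋ t′ → s ⊛ t ≋ s′ ⊛ t′
  ⊛-cong p q zero = *-cong (p 0) (q 0)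
  ⊛-cong p q (suc k) = +-cong (*-cong (p 0) (q (suc k))) (⊛-cong (p ∘ suc) q k)

  ⊛-distribʳ : ∀ u s t → (s ⊞ t) ⊛ u ≋ s ⊛ u ⊞ t ⊛ u
  ⊛-distribʳ u s t zero = distribʳ _ _ _
  ⊛-distribʳ u s t (suc k) = trans (+-congˡ (⊛-distribʳ u (tail s) (tail t) k))
    (solve 5 (λ a b c d e → (a :+ b) :* c :+ (d :+ e) := (a :* c :+ d) :+ (b :* c :+ e)) refl _ _ _ _ _)

  scale-⊛ : ∀ c s t → scale c s ⊛ t ≋ scale c (s ⊛ t)
  scale-⊛ c s t zero = *-assoc _ _ _
  scale-⊛ c s t (suc k) = trans (+-congˡ (scale-⊛ c (tail s) t k))
    (solve 4 (λ c a b d → c :* a :* b :+ c :* d := c :* (a :* b :+ d)) refl _ _ _ _)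

  0⊛ : ∀ t → 0ₛ ⊛ t ≋ 0ₛ
  0⊛ t zero = zeroˡ _
  0⊛ t (suc k) = trans (+-cong (zeroˡ _) (0⊛ t k)) (+-identityˡ 0#)

  const-⊛ : ∀ c t → const c ⊛ t ≋ scale c t
  const-⊛ c t zero = refl
  const-⊛ c t (suc k) = trans (+-congˡ (0⊛ t k)) (+-identityʳ _)

  -- Peels the right factor, whereas the definition of `⊛` peels the left one; commutativity rests
  -- on comparing the two.
  ⊛-suc′ : ∀ s t k → (s ⊛ t) (suc k) ≈ s (suc k) * t 0 + (s ⊛ tail t) k
  ⊛-suc′ s t zero = +-comm _ _
  ⊛-suc′ s t (suc k) = trans (+-congˡ (⊛-suc′ (tail s) t k))
    (solve 3 (λ a b c → a :+ (b :+ c) := b :+ (a :+ c)) refl _ _ _)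

  ⊛-comm : ∀ s t → s ⊛ t ≋ t ⊛ s
  ⊛-comm s t zero = *-comm _ _
  ⊛-comm s t (suc k) = trans (+-cong (*-comm _ _) (⊛-comm (tail s) t k)) (sym (⊛-suc′ t s k))

  ⊛-assoc : ∀ s t u → (s ⊛ t) ⊛ u ≋ s ⊛ (t ⊛ u)
  ⊛-assoc s t u zero = *-assoc _ _ _
  ⊛-assoc s t u (suc k) = begin
    s 0 * t 0 * u (suc k) + ((scale (s 0) (tail t) ⊞ tail s ⊛ t) ⊛ u) k
      ≈⟨ +-congˡ (⊛-distribʳ u (scale (s 0) (tail t)) (tail s ⊛ t) k) ⟩
    s 0 * t 0 * u (suc k) + ((scale (s 0) (tail t) ⊛ u) k + ((tail s ⊛ t) ⊛ u) k)
      ≈⟨ +-congˡ (+-cong (scale-⊛ (s 0) (tail t) u k) (⊛-assoc (tail s) t u k)) ⟩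
    s 0 * t 0 * u (suc k) + (s 0 * (tail t ⊛ u) k + (tail s ⊛ (t ⊛ u)) k)
      ≈⟨ solve 5 (λ a b c d e → a :* b :* c :+ (a :* d :+ e) := a :* (b :* c :+ d) :+ e) refl _ _ _ _ _ ⟩
    s 0 * (t 0 * u (suc k) + (tail t ⊛ u) k) + (tail s ⊛ (t ⊛ u)) k ∎

  seriesRing : CommutativeRing 0ℓ 0ℓ
  seriesRing = record
    { Carrier = Series ; _≈_ = _≋_ ; _+_ = _⊞_ ; _*_ = _⊛_ ; -_ = λ s k → - s k ; 0# = 0ₛ ; 1# = const 1#
    ; isCommutativeRing = record
      { isRing = record
        { +-isAbelianGroup = Pointwise.isAbelianGroup ℕ +-isAbelianGroup
        ; *-cong = ⊛-cong
        ; *-assoc = ⊛-assoc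
        ; *-identity = identityˡ , λ s k → trans (⊛-comm s (const 1#) k) (identityˡ s k)
        ; distrib = (λ u s t k → trans (⊛-comm u (s ⊞ t) k) (trans (⊛-distribʳ u s t k)
                                   (+-cong (⊛-comm s u k) (⊛-comm t u k))))
                  , ⊛-distribʳ
        }
      ; *-comm = ⊛-comm
      }
    }
    where
    identityˡ : ∀ s → const 1# ⊛ s ≋ s
    identityˡ s k = trans (const-⊛ 1# s k) (*-identityˡ _)

  module Seriesᵣ = CommutativeRing seriesRing

  -- Order at least `m` at the expansion point; `HasOrder` is the exact order.
  Van : Series → ℕ → Set
  Van s m = ∀ j → j ℕ.< m → s j ≈ 0#

  Van-tail : ∀ {s m} → Van s (suc m) → Van (tail s) m
  Van-tail v j j<m = v (suc j) (s≤s j<m)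

  Van-≤ : ∀ {s m n} → m ℕ.≤ n → Van s n → Van s m
  Van-≤ m≤n v j j<m = v j (ℕ.≤-trans j<m m≤n)

  Van-suc : ∀ {s m} → Van s m → s m ≈ 0# → Van s (suc m)
  Van-suc v e j (s≤s j≤m) with ℕ.m≤n⇒m<n∨m≡n j≤m
  ... | inj₁ j<m = v j j<m
  ... | inj₂ ≡.refl = e

  Van-≋ : ∀ {s t m} → s ≋ t → Van s m → Van t m
  Van-≋ e v j j<m = trans (sym (e j)) (v j j<m)

  Van-⊞ : ∀ {s t m} → Van s m → Van t m → Van (s ⊞ t) m
  Van-⊞ v w j j<m = trans (+-cong (v j j<m) (w j j<m)) (+-identityˡ 0#)

  Van-neg : ∀ {s m} → Van s m → Van (Seriesᵣ.- s) m
  Van-neg v j j<m = trans (-‿cong (v j j<m)) -0#≈0#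

  0*+ : ∀ {a b c d} → a ≈ 0# → c ≈ d → a * b + c ≈ d
  0*+ a≈0 c≈d = trans (+-cong (trans (*-congʳ a≈0) (zeroˡ _)) c≈d) (+-identityˡ _)

  Van-⊛ʳ : ∀ s {t n} → Van t n → Van (s ⊛ t) n
  Van-⊛ʳ s v zero 0<n = trans (*-congˡ (v 0 0<n)) (zeroʳ _)
  Van-⊛ʳ s v (suc j) j<n =
    trans (+-cong (trans (*-congˡ (v (suc j) j<n)) (zeroʳ _)) (Van-⊛ʳ (tail s) v j (ℕ.<-trans (ℕ.n<1+n j) j<n)))
          (+-identityˡ 0#)

  Van-⊛ : ∀ {s t} m {n} → Van s m → Van t n → Van (s ⊛ t) (m ℕ.+ n)
  Van-⊛ {s} zero v w = Van-⊛ʳ s w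
  Van-⊛ (suc m) v w zero _ = trans (*-congʳ (v 0 (s≤s z≤n))) (zeroˡ _)
  Van-⊛ (suc m) v w (suc j) (s≤s j<) = 0*+ (v 0 (s≤s z≤n)) (Van-⊛ m (Van-tail v) w j j<)

  lead-⊛ : ∀ {s t} m {n} → Van s m → Van t n → (s ⊛ t) (m ℕ.+ n) ≈ s m * t n
  lead-⊛ zero {zero} v w = refl
  lead-⊛ {s} zero {suc n} v w = trans (+-congˡ (Van-⊛ʳ (tail s) w n ℕ.≤-refl)) (+-identityʳ _)
  lead-⊛ (suc m) v w = 0*+ (v 0 (s≤s z≤n)) (lead-⊛ m (Van-tail v) w)

  HasOrder : Series → ℕ → Set
  HasOrder s m = Van s m × ¬ (s m ≈ 0#)

  order≤ : ∀ {s m n} → Van s m → HasOrder s n → m ℕ.≤ n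
  order≤ {s} {m} {n} v (_ , s≉0) with m ℕ.≤? n
  ... | yes p = p
  ... | no ¬p = ⊥-elim (s≉0 (v n (ℕ.≰⇒> ¬p)))

  order-unique : ∀ {s m n} → HasOrder s m → HasOrder s n → m ≡ n
  order-unique p q = ℕ.≤-antisym (order≤ (proj₁ p) q) (order≤ (proj₁ q) p)

  HasOrder-≋ : ∀ {s t m} → s ≋ t → HasOrder s m → HasOrder t m
  HasOrder-≋ {m = m} e (v , s≉0) = Van-≋ e v , λ t≈0 → s≉0 (trans (e m) t≈0)

  order∃ : ∀ s k → ¬ (s k ≈ 0#) → ∃[ m ] HasOrder s m
  order∃ s k sk≉0 = search (suc k) 0 (ℕ.≤-reflexive (≡.sym (ℕ.+-identityʳ _))) (λ _ ())
    where
    search : ∀ fuel m → suc k ℕ.≤ fuel ℕ.+ m → Van s m → ∃[ m ] HasOrder s m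
    search zero m k<m v = ⊥-elim (sk≉0 (v k k<m))
    search (suc fuel) m k< v with s m ≈0?
    ... | no ¬p = m , v , ¬p
    ... | yes p = search fuel (suc m) (ℕ.≤-trans k< (ℕ.≤-reflexive (≡.sym (ℕ.+-suc fuel m)))) (Van-suc v p)

  data Parity : ℕ → Set where
    even : ∀ i → Parity (i ℕ.+ i)
    odd : ∀ i → Parity (suc (i ℕ.+ i))

  parity : ∀ k → Parity k
  parity zero = even 0
  parity (suc k) with parity k
  ... | even i = odd i
  ... | odd i = ≡.subst Parity (≡.cong suc (ℕ.+-suc i i)) (even (suc i))

  -- To be read under `Van s k`. An odd lowest order would make the sign change across the expansion
  -- point, so at an odd position the coefficient has to vanish.
  LeadNonNeg : ∀ {k} → Series → Parity k → Set
  LeadNonNeg {k} s (even i) = 0# ≤ s k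
  LeadNonNeg {k} s (odd i) = s k ≈ 0#

  -- Nonnegativity on both sides of the expansion point.
  NonNeg : Series → Set
  NonNeg s = ∀ k → (p : Parity k) → Van s k → LeadNonNeg s p

  NonNeg-≋ : ∀ {s t} → s ≋ t → NonNeg s → NonNeg t
  NonNeg-≋ e ns k p@(even i) v = ≤-respʳ-≈ (e k) (ns k p (Van-≋ (sym ∘ e) v))
  NonNeg-≋ e ns k p@(odd i) v = trans (sym (e k)) (ns k p (Van-≋ (sym ∘ e) v))

  NonNeg-0 : NonNeg 0ₛ
  NonNeg-0 k (even i) v = ≤-refl
  NonNeg-0 k (odd i) v = refl

  -- Locally nonnegative series cannot cancel: at an even position two nonnegative coefficients add
  -- up to zero, and at an odd position both vanish already.
  NonNeg-split : ∀ {s t} k → NonNeg s → NonNeg t → Van (s ⊞ t) k → Van s k × Van t k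
  NonNeg-split zero ns nt v = (λ _ ()) , (λ _ ())
  NonNeg-split {s} {t} (suc k) ns nt v with NonNeg-split k ns nt (Van-≤ (ℕ.n≤1+n k) v)
  ... | vs , vt with parity k
  ...   | p@(even i) = let e = 0≤∧0≤∧+≈0⇒≈0 (ns k p vs) (nt k p vt) (v k ℕ.≤-refl)
                       in Van-suc vs (proj₁ e) , Van-suc vt (proj₂ e)
  ...   | p@(odd i) = Van-suc vs (ns k p vs) , Van-suc vt (nt k p vt)

  NonNeg-⊞ : ∀ {s t} → NonNeg s → NonNeg t → NonNeg (s ⊞ t)
  NonNeg-⊞ ns nt k p v with NonNeg-split k ns nt v
  NonNeg-⊞ ns nt k p@(even i) v | vs , vt = 0≤-+ (ns k p vs) (nt k p vt)
  NonNeg-⊞ ns nt k p@(odd i) v | vs , vt = trans (+-cong (ns k p vs) (nt k p vt)) (+-identityˡ 0#)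

  -- A square starts at twice the order of its root. The slack `suc k` rounds odd bounds up:
  -- vanishing below `2j+1` includes position `2j`, which gives order `j+1`.
  Van-√ : ∀ s {k} i → Van (s ⊛ s) k → i ℕ.+ i ℕ.≤ suc k → Van s i
  Van-√ s zero v _ = λ _ ()
  Van-√ s {k} (suc i) v 2i+2≤ = Van-suc vi (a²≈0⇒a≈0 (trans (sym (lead-⊛ i vi vi)) (v (i ℕ.+ i) 2i<k)))
    where
    2i<k : i ℕ.+ i ℕ.< k
    2i<k = ℕ.≤-pred (ℕ.≤-trans (ℕ.≤-reflexive (≡.cong suc (≡.sym (ℕ.+-suc i i)))) 2i+2≤)
    vi : Van s i
    vi = Van-√ s i v (ℕ.≤-trans (ℕ.<⇒≤ 2i<k) (ℕ.n≤1+n k))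

  NonNeg-square : ∀ s → NonNeg (s ⊛ s)
  NonNeg-square s k (even i) v = ≤-respʳ-≈ (sym (lead-⊛ i vi vi)) (0≤a² (s i))
    where vi = Van-√ s i v (ℕ.n≤1+n _)
  NonNeg-square s k (odd i) v = Van-⊛ (suc i) vi vi (suc (i ℕ.+ i)) (ℕ.≤-reflexive (≡.cong suc (≡.sym (ℕ.+-suc i i))))
    where vi = Van-√ s (suc i) v (ℕ.≤-reflexive (≡.cong suc (ℕ.+-suc i i)))

  ∂ : Series → Series
  ∂ s k = suc k · 1# * s (suc k)

  Van-∂ : ∀ {s m} → Van s (suc m) → Van (∂ s) m
  Van-∂ v j j<m = trans (*-congˡ (v (suc j) (s≤s j<m))) (zeroʳ _)

  linear : Carrier → Carrier → Series
  linear a b zero = a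
  linear a b (suc zero) = b
  linear a b (suc (suc k)) = 0#

  linear-⊛-suc : ∀ a b s k → (linear a b ⊛ s) (suc k) ≈ a * s (suc k) + b * s k
  linear-⊛-suc a b s k = +-congˡ (trans (⊛-cong {tail (linear a b)} {const b} {s} e (λ _ → refl) k) (const-⊛ b s k))
    where
    e : tail (linear a b) ≋ const b
    e zero = refl
    e (suc k) = refl

  linear₁-⊛-suc : ∀ a s k → (linear a 1# ⊛ s) (suc k) ≈ a * s (suc k) + s k
  linear₁-⊛-suc a s k = trans (linear-⊛-suc a 1# s k) (+-congˡ (*-identityˡ _))

  -- The product rule for a monic linear factor suffices, since vertex weights are products of such
  -- factors.
  ∂-linear-⊛ : ∀ θ s → ∂ (linear θ 1# ⊛ s) ≋ s ⊞ linear θ 1# ⊛ ∂ s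
  ∂-linear-⊛ θ s zero = begin
    (1# + 0#) * (linear θ 1# ⊛ s) 1    ≈⟨ *-cong (+-identityʳ 1#) (linear₁-⊛-suc θ s 0) ⟩
    1# * (θ * s 1 + s 0)               ≈⟨ solve 4 (λ o t a b → o :* (t :* a :+ b) := o :* b :+ t :* (o :* a)) refl 1# θ (s 1) (s 0) ⟩
    1# * s 0 + θ * (1# * s 1)          ≈⟨ +-cong (*-identityˡ _) (*-congˡ (*-congʳ (sym (+-identityʳ 1#)))) ⟩
    s 0 + θ * ((1# + 0#) * s 1)        ∎
  ∂-linear-⊛ θ s (suc k) = begin
    (1# + n) * (linear θ 1# ⊛ s) (suc (suc k))              ≈⟨ *-congˡ (linear₁-⊛-suc θ s (suc k)) ⟩
    (1# + n) * (θ * s (suc (suc k)) + s (suc k))            ≈⟨ solve 5 (λ o n t a b → (o :+ n) :* (t :* a :+ b) := o :* b :+ (t :* ((o :+ n) :* a) :+ n :* b)) refl 1# n θ _ _ ⟩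
    1# * s (suc k) + (θ * ∂ s (suc k) + n * s (suc k))      ≈⟨ +-cong (*-identityˡ _) (sym (linear₁-⊛-suc θ (∂ s) k)) ⟩
    s (suc k) + (linear θ 1# ⊛ ∂ s) (suc k)                 ∎
    where n = suc k · 1#

  ∂-⊞ : ∀ s t → ∂ (s ⊞ t) ≋ ∂ s ⊞ ∂ t
  ∂-⊞ s t k = distribˡ _ _ _

  ∂-neg : ∀ s → ∂ (Seriesᵣ.- s) ≋ Seriesᵣ.- ∂ s
  ∂-neg s k = sym (-‿distribʳ-* _ _)

  ∂-const : ∀ c → ∂ (const c) ≋ 0ₛ
  ∂-const c k = zeroʳ _

-- Deleting vertices and edges from vertex subsets.

Edge : ℕ → Set
Edge n = Fin n × Fin n

eqᵇ-refl : ∀ {n} (u : Fin n) → eqᵇ u u ≡ true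
eqᵇ-refl u = dec-true (u ≟ u) ≡.refl

eqᵇ-≢ : ∀ {n} {u v : Fin n} → u ≢ v → eqᵇ u v ≡ false
eqᵇ-≢ {u = u} {v} = dec-false (u ≟ v)

eqᵇ-sym : ∀ {n} (u v : Fin n) → eqᵇ u v ≡ eqᵇ v u
eqᵇ-sym u v with u ≟ v
... | yes ≡.refl = ≡.sym (eqᵇ-refl v)
... | no u≢v = ≡.sym (eqᵇ-≢ (u≢v ∘ ≡.sym))

infixl 8 _∖_ _∖ₑ_

_∖_ : ∀ {n} → Subset n → Fin n → Subset n
U ∖ v = U [ v ]≔ false

_∖ₑ_ : ∀ {n} → Subset n → Edge n → Subset n
U ∖ₑ (i , j) = U ∖ i ∖ j

lookup-∖ : ∀ {n} (U : Subset n) u w → lookup (U ∖ u) w ≡ lookup U w ∧ not (eqᵇ u w)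
lookup-∖ U u w with u ≟ w
... | yes ≡.refl = ≡.trans (Vec.lookup∘update u U false) (≡.sym (Bool.∧-zeroʳ _))
... | no u≢w = ≡.trans (Vec.lookup∘update′ (u≢w ∘ ≡.sym) U false) (≡.sym (Bool.∧-identityʳ _))

lookup-∖-≢ : ∀ {n} (U : Subset n) {u w} → u ≢ w → lookup (U ∖ u) w ≡ lookup U w
lookup-∖-≢ U u≢w = Vec.lookup∘update′ (u≢w ∘ ≡.sym) U false

lookup-∖-≡ : ∀ {n} (U : Subset n) u → lookup (U ∖ u) u ≡ false
lookup-∖-≡ U u = Vec.lookup∘update u U false

lookup-∖⇒≢ : ∀ {n} (U : Subset n) u {w} → lookup (U ∖ u) w ≡ true → u ≢ w
lookup-∖⇒≢ U u p ≡.refl with () ← ≡.trans (≡.sym p) (lookup-∖-≡ U u)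

lookup-∖⇒ : ∀ {n} (U : Subset n) u {w} → lookup (U ∖ u) w ≡ true → lookup U w ≡ true
lookup-∖⇒ U u p = ≡.trans (≡.sym (lookup-∖-≢ U (lookup-∖⇒≢ U u p))) p

∖-comm : ∀ {n} (U : Subset n) u v → U ∖ u ∖ v ≡ U ∖ v ∖ u
∖-comm U u v with u ≟ v
... | yes ≡.refl = ≡.refl
... | no u≢v = Vec.[]≔-commutes U u v u≢v

∖-∖ₑ-comm : ∀ {n} (U : Subset n) u e → U ∖ u ∖ₑ e ≡ U ∖ₑ e ∖ u
∖-∖ₑ-comm U u (i , j) = ≡.trans (≡.cong (_∖ j) (∖-comm U u i)) (∖-comm (U ∖ i) u j)

∖ₑ-comm : ∀ {n} (U : Subset n) e f → U ∖ₑ e ∖ₑ f ≡ U ∖ₑ f ∖ₑ e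
∖ₑ-comm U e (k , l) = ≡.trans (≡.cong (_∖ l) (≡.sym (∖-∖ₑ-comm U k e))) (≡.sym (∖-∖ₑ-comm (U ∖ k) l e))

inc : ∀ {n} → Fin n → Edge n → Bool
inc v (i , j) = eqᵇ v i ∨ eqᵇ v j

lookup-∖ₑ : ∀ {n} (U : Subset n) e w → lookup (U ∖ₑ e) w ≡ lookup U w ∧ not (inc w e)
lookup-∖ₑ U (i , j) w
  rewrite lookup-∖ (U ∖ i) j w | lookup-∖ U i w | eqᵇ-sym i w | eqᵇ-sym j w
  = ≡.trans (Bool.∧-assoc (lookup U w) _ _) (≡.cong (lookup U w ∧_) (not-∨ (eqᵇ w i) (eqᵇ w j)))
  where
  not-∨ : ∀ a b → not a ∧ not b ≡ not (a ∨ b)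
  not-∨ true b = ≡.refl
  not-∨ false b = ≡.refl

lookup-∖ₑ-inc : ∀ {n} (U : Subset n) v f → inc v f ≡ true → lookup (U ∖ₑ f) v ≡ false
lookup-∖ₑ-inc U v f p rewrite lookup-∖ₑ U f v | p = Bool.∧-zeroʳ _

lookup-∖ₑ-disjoint : ∀ {n} (U : Subset n) v f → inc v f ≡ false → lookup (U ∖ₑ f) v ≡ lookup U v
lookup-∖ₑ-disjoint U v f p rewrite lookup-∖ₑ U f v | p = Bool.∧-identityʳ _

ok : ∀ {n} → Graph n → Subset n → Edge n → Bool
ok G U (i , j) = adj G i j ∧ lookup U i ∧ lookup U j

module _ {n} (G : Graph n) where
  open ∨-∧-Solver using (solve; _:=_; _:*_)

  -- Both sides say that `e` is an edge inside `U` and that `v` is a vertex of `U` off `e`. With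
  -- this, deletion of a vertex passes through the edge recursion of `Z`.
  ok-∖ : ∀ U v e → lookup U v ∧ ok G (U ∖ v) e ≡ ok G U e ∧ lookup (U ∖ₑ e) v
  ok-∖ U v (i , j)
    rewrite lookup-∖ U v i | lookup-∖ U v j | lookup-∖ (U ∖ i) j v | lookup-∖ U i v
          | eqᵇ-sym v i | eqᵇ-sym v j
    = solve 6 (λ v a i j p q → v :* (a :* ((i :* p) :* (j :* q))) := (a :* (i :* j)) :* ((v :* p) :* q))
        ≡.refl (lookup U v) (adj G i j) (lookup U i) (lookup U j) (not (eqᵇ i v)) (not (eqᵇ j v))

  -- The condition is symmetric: `e` and `f` are disjoint edges inside `U`.
  ok-∖ₑ : ∀ U e f → ok G U f ∧ ok G (U ∖ₑ f) e ≡ ok G U e ∧ ok G (U ∖ₑ e) f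
  ok-∖ₑ U (i , j) (k , l)
    rewrite lookup-∖ (U ∖ k) l i | lookup-∖ U k i | lookup-∖ (U ∖ k) l j | lookup-∖ U k j
          | lookup-∖ (U ∖ i) j k | lookup-∖ U i k | lookup-∖ (U ∖ i) j l | lookup-∖ U i l
          | eqᵇ-sym k i | eqᵇ-sym k j | eqᵇ-sym l i | eqᵇ-sym l j
    = solve 10 (λ a b i j k l p q r s →
          (b :* (k :* l)) :* (a :* (((i :* p) :* q) :* ((j :* r) :* s)))
          := (a :* (i :* j)) :* (b :* (((k :* p) :* r) :* ((l :* q) :* s))))
        ≡.refl (adj G i j) (adj G k l) (lookup U i) (lookup U j) (lookup U k) (lookup U l)
        (not (eqᵇ i k)) (not (eqᵇ i l)) (not (eqᵇ j k)) (not (eqᵇ j l))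

  ok-inc : ∀ U v e → inc v e ≡ true → lookup U v ≡ false → ok G U e ≡ false
  ok-inc U v (i , j) p q with v ≟ i | v ≟ j
  ... | yes ≡.refl | _ rewrite q = Bool.∧-zeroʳ _
  ... | no _ | yes ≡.refl rewrite q | Bool.∧-zeroʳ (lookup U i) = Bool.∧-zeroʳ _

  ok-∖-disjoint : ∀ U v e → inc v e ≡ false → ok G (U ∖ v) e ≡ ok G U e
  ok-∖-disjoint U v (i , j) p rewrite lookup-∖ U v i | lookup-∖ U v j with eqᵇ v i | eqᵇ v j
  ... | false | false rewrite Bool.∧-identityʳ (lookup U i) | Bool.∧-identityʳ (lookup U j) = ≡.refl

  -- If `f` misses `v`, or if `e` meets `v` too, both sides are false, because matching edges cannot
  -- share `v`. The remaining case is the symmetry `ok-∖ₑ`.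
  ok-∖ₑ-inc : ∀ U v e f → (inc v f ∧ ok G U f) ∧ ok G (U ∖ₑ f) e
                        ≡ (ok G U e ∧ not (inc v e)) ∧ (inc v f ∧ ok G (U ∖ₑ e) f)
  ok-∖ₑ-inc U v e f with inc v f in vf | inc v e in ve
  ... | false | _ = ≡.sym (Bool.∧-zeroʳ _)
  ... | true | false rewrite Bool.∧-identityʳ (ok G U e) = ok-∖ₑ U e f
  ... | true | true rewrite ok-inc (U ∖ₑ f) v e ve (lookup-∖ₑ-inc U v f vf) | Bool.∧-zeroʳ (ok G U f) | Bool.∧-zeroʳ (ok G U e) = ≡.refl

-- Guarded finite sums over vertices and over edge lists.

module FiniteSums (R : CommutativeRing 0ℓ 0ℓ) where
  open CommutativeRing R hiding (zero)
  open import Algebra.Properties.Ring ring using (-0#≈0#)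
  open import Algebra.Properties.AbelianGroup +-abelianGroup using (⁻¹-∙-comm)
  open import Algebra.Properties.Semiring.Sum semiring using (sum; sum-cong-≋; ∑-distrib-+; sum-replicate-zero; *-distribˡ-sum; *-distribʳ-sum) public
  open IntegerCoefficientSolver R using (solve; _:=_; _:+_; _:*_; _:-_; :-_; :0)
  open import Relation.Binary.Reasoning.Setoid setoid

  when : Bool → Carrier → Carrier
  when true s = s
  when false s = 0#

  when-cong : ∀ b {s t} → s ≈ t → when b s ≈ when b t
  when-cong true e = e
  when-cong false e = refl

  when-≡ : ∀ {a b} → a ≡ b → ∀ s → when a s ≈ when b s
  when-≡ ≡.refl s = refl

  when-∧ : ∀ a b {s} → when (a ∧ b) s ≈ when a (when b s)
  when-∧ true b = refl
  when-∧ false b = refl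

  when-swap : ∀ a b c d {s t} → a ∧ b ≡ c ∧ d → s ≈ t → when a (when b s) ≈ when c (when d t)
  when-swap a b c d p q =
    trans (sym (when-∧ a b)) (trans (when-≡ p _) (trans (when-∧ c d) (when-cong c (when-cong d q))))

  when-+ : ∀ b {s t} → when b (s + t) ≈ when b s + when b t
  when-+ true = refl
  when-+ false = sym (+-identityˡ 0#)

  when-neg : ∀ b {s} → when b (- s) ≈ - when b s
  when-neg true = refl
  when-neg false = sym -0#≈0#

  when-- : ∀ b {s t} → when b (s - t) ≈ when b s - when b t
  when-- b = trans (when-+ b) (+-congˡ (when-neg b))

  when-* : ∀ b {s t} → when b (s * t) ≈ s * when b t
  when-* true = refl
  when-* false = sym (zeroʳ _)

  sum-neg : ∀ {n} (f : Fin n → Carrier) → sum (λ i → - f i) ≈ - sum f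
  sum-neg {zero} f = sym -0#≈0#
  sum-neg {suc n} f = trans (+-congˡ (sum-neg (f ∘ suc))) (⁻¹-∙-comm _ _)

  sum-- : ∀ {n} (f g : Fin n → Carrier) → sum (λ i → f i - g i) ≈ sum f - sum g
  sum-- f g = trans (∑-distrib-+ f (λ i → - g i)) (+-congˡ (sum-neg g))

  sum-when : ∀ {n} b (f : Fin n → Carrier) → sum (λ i → when b (f i)) ≈ when b (sum f)
  sum-when true f = refl
  sum-when {n} false f = sum-replicate-zero n

  sum-δ : ∀ {n} v (f : Fin n → Carrier) → sum (λ i → when (eqᵇ v i) (f i)) ≈ f v
  sum-δ {suc n} zero f = trans (+-congˡ (sum-replicate-zero n)) (+-identityʳ _)
  sum-δ (suc v) f = trans (+-identityˡ _) (sum-δ v (f ∘ suc))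

  listSum : {A : Set} → (A → Carrier) → List A → Carrier
  listSum f [] = 0#
  listSum f (a ∷ as) = f a + listSum f as

  listSum-cong : {A : Set} {f g : A → Carrier} → (∀ a → f a ≈ g a) → ∀ as → listSum f as ≈ listSum g as
  listSum-cong e [] = refl
  listSum-cong e (a ∷ as) = +-cong (e a) (listSum-cong e as)

  listSum-- : {A : Set} (f g : A → Carrier) → ∀ as → listSum (λ a → f a - g a) as ≈ listSum f as - listSum g as
  listSum-- f g [] = sym (-‿inverseʳ 0#)
  listSum-- f g (a ∷ as) = trans (+-congˡ (listSum-- f g as))
    (solve 4 (λ a b c d → (a :- b) :+ (c :- d) := (a :+ c) :- (b :+ d)) refl _ _ _ _)

  listSum-when : {A : Set} (b : Bool) (f : A → Carrier) → ∀ as → listSum (λ a → when b (f a)) as ≈ when b (listSum f as)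
  listSum-when true f as = refl
  listSum-when false f [] = refl
  listSum-when false f (a ∷ as) = trans (+-identityˡ _) (listSum-when false f as)

  listSum-++ : {A : Set} (f : A → Carrier) → ∀ as bs → listSum f (as ++ bs) ≈ listSum f as + listSum f bs
  listSum-++ f [] bs = sym (+-identityˡ _)
  listSum-++ f (a ∷ as) bs = trans (+-congˡ (listSum-++ f as bs)) (sym (+-assoc _ _ _))

  listSum-concatMap : {A B : Set} (f : B → Carrier) (g : A → List B) → ∀ as → listSum f (concatMap g as) ≈ listSum (listSum f ∘ g) as
  listSum-concatMap f g [] = refl
  listSum-concatMap f g (a ∷ as) = trans (listSum-++ f (g a) _) (+-congˡ (listSum-concatMap f g as))

  listSum-tabulate : {A : Set} (f : A → Carrier) → ∀ {n} (g : Fin n → A) → listSum f (List.tabulate g) ≈ sum (f ∘ g)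
  listSum-tabulate f {zero} g = refl
  listSum-tabulate f {suc n} g = +-congˡ (listSum-tabulate f (g ∘ suc))

  <ᵇ-true : ∀ {m n} → m ℕ.< n → (suc m ≤ᵇ n) ≡ true
  <ᵇ-true p = Equivalence.to Bool.T-≡ (ℕ.≤⇒≤ᵇ p)

  <ᵇ-false : ∀ {m n} → ¬ (m ℕ.< n) → (suc m ≤ᵇ n) ≡ false
  <ᵇ-false {m} {n} p with suc m ≤ᵇ n in e
  ... | false = ≡.refl
  ... | true = ⊥-elim (p (ℕ.≤ᵇ⇒≤ (suc m) n (Equivalence.from Bool.T-≡ e)))

  listSum-pairs : ∀ {n} (f : Edge n → Carrier) →
    listSum f (pairs n) ≈ sum (λ i → sum (λ j → when (suc (toℕ i) ≤ᵇ toℕ j) (f (i , j))))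
  listSum-pairs {n} f =
    trans (listSum-concatMap f (λ i → concatMap (single i) (allFin n)) (allFin n))
      (trans (listSum-tabulate _ {n} (λ i → i)) (sum-cong-≋ λ i →
        trans (listSum-concatMap f (single i) (allFin n))
          (trans (listSum-tabulate _ {n} (λ j → j)) (sum-cong-≋ λ j → one i j))))
    where
    single : Fin n → Fin n → List (Edge n)
    single i j = if suc (toℕ i) ≤ᵇ toℕ j then (i , j) ∷ [] else []
    one : ∀ i j → listSum f (single i j) ≈ when (suc (toℕ i) ≤ᵇ toℕ j) (f (i , j))
    one i j with suc (toℕ i) ≤ᵇ toℕ j
    ... | true = +-identityʳ _
    ... | false = refl

  -- Since `pairs` lists each pair once, smaller index first, the pairs at `v` split into those
  -- whose other end is above `v` and those whose other end is below. The right side also has a term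
  -- at `v` itself, hence the condition on `h v v`.
  listSum-incident : ∀ {n} v (h : Fin n → Fin n → Carrier) → (∀ i j → h i j ≈ h j i) → h v v ≈ 0# →
    listSum (λ { (i , j) → when (inc v (i , j)) (h i j) }) (pairs n) ≈ sum (h v)
  listSum-incident {n} v h h-sym hvv = begin
    listSum _ (pairs n)
      ≈⟨ listSum-pairs {n} _ ⟩
    sum (λ i → sum (λ j → when (suc (toℕ i) ≤ᵇ toℕ j) (when (inc v (i , j)) (h i j))))
      ≈⟨ sum-cong-≋ (λ i → trans (sum-cong-≋ (λ j → split i j)) (∑-distrib-+ {n} _ _)) ⟩
    sum (λ i → sum (λ j → when (eqᵇ v i) (above j)) + sum (λ j → when (eqᵇ v j) (below i)))
      ≈⟨ ∑-distrib-+ {n} _ _ ⟩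
    sum (λ i → sum (λ j → when (eqᵇ v i) (above j))) + sum (λ i → sum (λ j → when (eqᵇ v j) (below i)))
      ≈⟨ +-cong (trans (sum-cong-≋ λ i → sum-when (eqᵇ v i) above) (sum-δ v (λ _ → sum above)))
                (sum-cong-≋ λ i → sum-δ v (λ _ → below i)) ⟩
    sum above + sum below
      ≈⟨ ∑-distrib-+ above below ⟨
    sum (λ w → above w + below w)
      ≈⟨ sum-cong-≋ join ⟩
    sum (h v) ∎
    where
    above below : Fin n → Carrier
    above j = when (suc (toℕ v) ≤ᵇ toℕ j) (h v j)
    below i = when (suc (toℕ i) ≤ᵇ toℕ v) (h i v)
    split : ∀ i j → when (suc (toℕ i) ≤ᵇ toℕ j) (when (inc v (i , j)) (h i j))
                  ≈ when (eqᵇ v i) (above j) + when (eqᵇ v j) (below i)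
    split i j with v ≟ i | v ≟ j
    ... | yes ≡.refl | yes ≡.refl rewrite <ᵇ-false (ℕ.<-irrefl {toℕ v} ≡.refl) = sym (+-identityˡ _)
    ... | yes ≡.refl | no _ = sym (+-identityʳ _)
    ... | no _ | yes ≡.refl = sym (+-identityˡ _)
    ... | no _ | no _ = trans (when-0 (suc (toℕ i) ≤ᵇ toℕ j)) (sym (+-identityˡ _))
      where
      when-0 : ∀ b → when b 0# ≈ 0#
      when-0 true = refl
      when-0 false = refl
    join : ∀ w → above w + below w ≈ h v w
    join w with ℕ.<-cmp (toℕ v) (toℕ w)
    ... | tri< p _ q rewrite <ᵇ-true p | <ᵇ-false q = +-identityʳ _
    ... | tri> q _ p rewrite <ᵇ-true p | <ᵇ-false q = trans (+-identityˡ _) (h-sym w v)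
    ... | tri≈ p e q with ≡.refl ← toℕ-injective e rewrite <ᵇ-false q = trans (+-identityˡ _) (sym hvv)

-- The matching polynomial with arbitrary vertex weights.

module MatchingSum (R : CommutativeRing 0ℓ 0ℓ) where
  open CommutativeRing R hiding (zero)
  open FiniteSums R
  open IntegerCoefficientSolver R using (solve; _:=_; _:+_; _:*_; _:-_; :-_; :0)
  open import Relation.Binary.Reasoning.Setoid setoid

  weight : ∀ {n} → (Fin n → Carrier) → Subset n → Carrier
  weight x [] = 1#
  weight x (true ∷ U) = x zero * weight (x ∘ suc) U
  weight x (false ∷ U) = weight (x ∘ suc) U

  weight-∖ : ∀ {n} (x : Fin n → Carrier) U v → lookup U v ≡ true → weight x U ≈ x v * weight x (U ∖ v)
  weight-∖ x (true ∷ U) zero p = refl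
  weight-∖ x (false ∷ U) (suc v) p = weight-∖ (x ∘ suc) U v p
  weight-∖ x (true ∷ U) (suc v) p = trans (*-congˡ (weight-∖ (x ∘ suc) U v p))
    (solve 3 (λ a b c → a :* (b :* c) := b :* (a :* c)) refl _ _ _)

  weight-cong : ∀ {n} {x y : Fin n → Carrier} → (∀ v → x v ≈ y v) → ∀ U → weight x U ≈ weight y U
  weight-cong e [] = refl
  weight-cong e (true ∷ U) = *-cong (e zero) (weight-cong (e ∘ suc) U)
  weight-cong e (false ∷ U) = weight-cong (e ∘ suc) U

  weight-perturb : ∀ {n} (x y : Fin n → Carrier) v t → (∀ w → y w ≈ x w + when (eqᵇ v w) t) →
    ∀ U → weight y U ≈ weight x U + when (lookup U v) (t * weight x (U ∖ v))
  weight-perturb x y zero t e (true ∷ U) = trans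
    (*-cong (e zero) (weight-cong (λ w → trans (e (suc w)) (+-identityʳ _)) U)) (distribʳ _ _ _)
  weight-perturb x y zero t e (false ∷ U) =
    trans (weight-cong (λ w → trans (e (suc w)) (+-identityʳ _)) U) (sym (+-identityʳ _))
  weight-perturb x y (suc v) t e (false ∷ U) = weight-perturb (x ∘ suc) (y ∘ suc) v t (e ∘ suc) U
  weight-perturb x y (suc v) t e (true ∷ U) = begin
    y zero * weight (y ∘ suc) U
      ≈⟨ *-cong (trans (e zero) (+-identityʳ _)) (weight-perturb (x ∘ suc) (y ∘ suc) v t (e ∘ suc) U) ⟩
    x zero * (weight (x ∘ suc) U + when (lookup U v) (t * weight (x ∘ suc) (U ∖ v)))
      ≈⟨ distribˡ _ _ _ ⟩
    x zero * weight (x ∘ suc) U + x zero * when (lookup U v) (t * weight (x ∘ suc) (U ∖ v))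
      ≈⟨ +-congˡ (sym (when-* (lookup U v))) ⟩
    x zero * weight (x ∘ suc) U + when (lookup U v) (x zero * (t * weight (x ∘ suc) (U ∖ v)))
      ≈⟨ +-congˡ (when-cong (lookup U v) (solve 3 (λ a b c → a :* (b :* c) := b :* (a :* c)) refl _ _ _)) ⟩
    x zero * weight (x ∘ suc) U + when (lookup U v) (t * (x zero * weight (x ∘ suc) (U ∖ v))) ∎

  -- Σ (-1)^∣M∣ Π x over the matchings M ⊆ L of G[U], the product being over the unmatched vertices of U.
  Z : ∀ {n} → Graph n → (Fin n → Carrier) → List (Edge n) → Subset n → Carrier
  Z G x [] U = weight x U
  Z G x (e ∷ L) U = Z G x L U - when (ok G U e) (Z G x L (U ∖ₑ e))

  module _ {n} (G : Graph n) (x : Fin n → Carrier) where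

    Z-≡ : ∀ L {U U′} → U ≡ U′ → Z G x L U ≈ Z G x L U′
    Z-≡ L ≡.refl = refl

    -- The candidates `L′` for the edge at `v` are kept apart from the edges `L` of the rest of the
    -- matching, so that `L` can grow while `L′` stays fixed.
    incidentSum : List (Edge n) → List (Edge n) → Subset n → Fin n → Carrier
    incidentSum L′ L U v = listSum (λ f → when (inc v f ∧ ok G U f) (Z G x L (U ∖ₑ f))) L′

    incidentSum-∷ : ∀ L′ e L U v → incidentSum L′ (e ∷ L) U v
      ≈ incidentSum L′ L U v - when (ok G U e ∧ not (inc v e)) (incidentSum L′ L (U ∖ₑ e) v)
    incidentSum-∷ L′ e L U v = begin
      listSum (λ f → when (inc v f ∧ ok G U f) (Z G x L (U ∖ₑ f) - when (ok G (U ∖ₑ f) e) (Z G x L (U ∖ₑ f ∖ₑ e)))) L′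
        ≈⟨ listSum-cong (λ f → trans (when-- (inc v f ∧ ok G U f))
             (+-congˡ (-‿cong (when-swap (inc v f ∧ ok G U f) _ (ok G U e ∧ not (inc v e)) _ (ok-∖ₑ-inc G U v e f) (Z-≡ L (∖ₑ-comm U f e)))))) L′ ⟩
      listSum (λ f → when (inc v f ∧ ok G U f) (Z G x L (U ∖ₑ f))
                   - when (ok G U e ∧ not (inc v e)) (when (inc v f ∧ ok G (U ∖ₑ e) f) (Z G x L (U ∖ₑ e ∖ₑ f)))) L′
        ≈⟨ listSum-- _ _ L′ ⟩
      incidentSum L′ L U v
        - listSum (λ f → when (ok G U e ∧ not (inc v e)) (when (inc v f ∧ ok G (U ∖ₑ e) f) (Z G x L (U ∖ₑ e ∖ₑ f)))) L′
        ≈⟨ +-congˡ (-‿cong (listSum-when (ok G U e ∧ not (inc v e)) _ L′)) ⟩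
      incidentSum L′ L U v - when (ok G U e ∧ not (inc v e)) (incidentSum L′ L (U ∖ₑ e) v) ∎

    -- A matching either leaves `v` bare, which gives the factor `x v`, or uses exactly one edge at
    -- `v`, which gives a minus sign. Induction on `L`: a new edge at `v` becomes a summand of the
    -- incident sum, any other edge recurses in both parts.
    Z-incident : ∀ L U v → lookup U v ≡ true → Z G x L U ≈ x v * Z G x L (U ∖ v) - incidentSum L L U v
    Z-incident [] U v p = trans (weight-∖ x U v p) (solve 1 (λ a → a := a :- :0) refl _)
    Z-incident (e ∷ L) U v p with inc v e in q
    -- An edge at `v` is inadmissible once `v` is deleted, so `e` survives only as its own summand.
    ... | true
      rewrite ok-inc G (U ∖ v) v e q (lookup-∖-≡ U v) | ok-inc G (U ∖ₑ e) v e q (lookup-∖ₑ-inc U v e q)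
      = begin
        Z G x L U - when (ok G U e) (Z G x L (U ∖ₑ e))
          ≈⟨ +-congʳ (Z-incident L U v p) ⟩
        x v * Z G x L (U ∖ v) - incidentSum L L U v - when (ok G U e) (Z G x L (U ∖ₑ e))
          ≈⟨ solve 4 (λ x z i w → x :* z :- i :- w := x :* (z :- :0) :- (w :+ (i :- :0))) refl _ _ _ _ ⟩
        x v * (Z G x L (U ∖ v) - 0#) - (when (ok G U e) (Z G x L (U ∖ₑ e)) + (incidentSum L L U v - 0#))
          ≈⟨ +-congˡ (-‿cong (+-cong (when-cong (ok G U e) (solve 1 (λ a → a := a :- :0) refl _)) (sym (trans (incidentSum-∷ L e L U v)
               (+-congˡ (-‿cong (when-≡ no-e (incidentSum L L (U ∖ₑ e) v)))))))) ⟩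
        x v * (Z G x L (U ∖ v) - 0#) - (when (ok G U e) (Z G x L (U ∖ₑ e) - 0#) + incidentSum L (e ∷ L) U v) ∎
      where
      no-e : ok G U e ∧ not (inc v e) ≡ false
      no-e rewrite q = Bool.∧-zeroʳ _
    ... | false
      rewrite ok-∖-disjoint G U v e q
      = begin
        Z G x L U - when (ok G U e) (Z G x L (U ∖ₑ e))
          ≈⟨ +-cong (Z-incident L U v p) (-‿cong (when-cong (ok G U e)
               (trans (Z-incident L (U ∖ₑ e) v (≡.trans (lookup-∖ₑ-disjoint U v e q) p))
                      (+-congʳ (*-congˡ (Z-≡ L (≡.sym (∖-∖ₑ-comm U v e)))))))) ⟩
        x v * Z G x L (U ∖ v) - incidentSum L L U v
          - when (ok G U e) (x v * Z G x L (U ∖ v ∖ₑ e) - incidentSum L L (U ∖ₑ e) v)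
          ≈⟨ +-congˡ (-‿cong (trans (when-- (ok G U e)) (+-congʳ (when-* (ok G U e))))) ⟩
        x v * Z G x L (U ∖ v) - incidentSum L L U v
          - (x v * when (ok G U e) (Z G x L (U ∖ v ∖ₑ e)) - when (ok G U e) (incidentSum L L (U ∖ₑ e) v))
          ≈⟨ solve 5 (λ x z i y j → x :* z :- i :- (x :* y :- j) := x :* (z :- y) :- (:0 :+ (i :- j))) refl _ _ _ _ _ ⟩
        x v * (Z G x L (U ∖ v) - when (ok G U e) (Z G x L (U ∖ v ∖ₑ e)))
          - (0# + (incidentSum L L U v - when (ok G U e) (incidentSum L L (U ∖ₑ e) v)))
          ≈⟨ +-congˡ (-‿cong (+-congˡ (sym (trans (incidentSum-∷ L e L U v)
               (+-congˡ (-‿cong (when-≡ e-ok (incidentSum L L (U ∖ₑ e) v)))))))) ⟩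
        x v * (Z G x L (U ∖ v) - when (ok G U e) (Z G x L (U ∖ v ∖ₑ e))) - (0# + incidentSum L (e ∷ L) U v) ∎
      where
      e-ok : ok G U e ∧ not (inc v e) ≡ ok G U e
      e-ok rewrite q = Bool.∧-identityʳ _

    -- The edges at `v` are indexed by their other end `w`, which turns the incident sum into a sum
    -- over neighbours.
    Z-vertex : ∀ U v → lookup U v ≡ true → Z G x (pairs n) U ≈
      x v * Z G x (pairs n) (U ∖ v) - sum (λ w → when (adj G v w ∧ lookup U w) (Z G x (pairs n) (U ∖ v ∖ w)))
    Z-vertex U v p = begin
      Z G x L U
        ≈⟨ Z-incident L U v p ⟩
      x v * Z G x L (U ∖ v) - incidentSum L L U v
        ≈⟨ +-congˡ (-‿cong (listSum-cong (λ f → when-∧ (inc v f) (ok G U f)) L)) ⟩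
      x v * Z G x L (U ∖ v) - listSum (λ f → when (inc v f) (when (ok G U f) (Z G x L (U ∖ₑ f)))) L
        ≈⟨ +-congˡ (-‿cong (listSum-incident v h h-sym hvv)) ⟩
      x v * Z G x L (U ∖ v) - sum (h v)
        ≈⟨ +-congˡ (-‿cong (sum-cong-≋ (λ w → reflexive (≡.cong (λ b → when (adj G v w ∧ b ∧ lookup U w) (Z G x L (U ∖ v ∖ w))) p)))) ⟩
      x v * Z G x L (U ∖ v) - sum (λ w → when (adj G v w ∧ lookup U w) (Z G x L (U ∖ v ∖ w))) ∎
      where
      L = pairs n
      h : Fin n → Fin n → Carrier
      h i j = when (ok G U (i , j)) (Z G x L (U ∖ₑ (i , j)))
      h-sym : ∀ i j → h i j ≈ h j i
      h-sym i j rewrite adj-sym G i j | Bool.∧-comm (lookup U i) (lookup U j) =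
        when-cong (adj G j i ∧ lookup U j ∧ lookup U i) (Z-≡ L (∖-comm U i j))
      hvv : h v v ≈ 0#
      hvv rewrite irrefl G v = refl

    -- Each vertex weight occurs at most to the first power in every summand, so `Z` is affine in
    -- `x v`; the slope collects the matchings that leave `v` bare.
    Z-perturb : ∀ y v t → (∀ w → y w ≈ x w + when (eqᵇ v w) t) →
      ∀ L U → Z G y L U ≈ Z G x L U + when (lookup U v) (t * Z G x L (U ∖ v))
    Z-perturb y v t e [] U = weight-perturb x y v t e U
    Z-perturb y v t eq (e ∷ L) U = begin
      Z G y L U - when o (Z G y L (U ∖ₑ e))
        ≈⟨ +-cong (Z-perturb y v t eq L U) (-‿cong (trans (when-cong o (Z-perturb y v t eq L (U ∖ₑ e))) (when-+ o))) ⟩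
      (Z G x L U + when l (t * Z G x L (U ∖ v)))
        - (when o (Z G x L (U ∖ₑ e)) + when o (when (lookup (U ∖ₑ e) v) (t * Z G x L (U ∖ₑ e ∖ v))))
        ≈⟨ solve 4 (λ a b c d → (a :+ b) :- (c :+ d) := (a :- c) :+ (b :- d)) refl _ _ _ _ ⟩
      (Z G x L U - when o (Z G x L (U ∖ₑ e)))
        + (when l (t * Z G x L (U ∖ v)) - when o (when (lookup (U ∖ₑ e) v) (t * Z G x L (U ∖ₑ e ∖ v))))
        ≈⟨ +-congˡ (+-congˡ (-‿cong (when-swap o _ l _ (≡.sym (ok-∖ G U v e)) (*-congˡ (Z-≡ L (≡.sym (∖-∖ₑ-comm U v e))))))) ⟩
      (Z G x L U - when o (Z G x L (U ∖ₑ e)))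
        + (when l (t * Z G x L (U ∖ v)) - when l (when (ok G (U ∖ v) e) (t * Z G x L (U ∖ v ∖ₑ e))))
        ≈⟨ +-congˡ (trans (sym (when-- l)) (when-cong l (trans (+-congˡ (-‿cong (when-* (ok G (U ∖ v) e))))
             (solve 3 (λ t a b → t :* a :- t :* b := t :* (a :- b)) refl _ _ _)))) ⟩
      (Z G x L U - when o (Z G x L (U ∖ₑ e)))
        + when l (t * (Z G x L (U ∖ v) - when (ok G (U ∖ v) e) (Z G x L (U ∖ v ∖ₑ e)))) ∎
      where
      o = ok G U e
      l = lookup U v

  -- Edges with an end outside `U` are inadmissible in both graphs, so only adjacency inside `U`
  -- matters.
  Z-agree : ∀ {n} (G H : Graph n) x L U →
    (∀ i j → lookup U i ≡ true → lookup U j ≡ true → adj G i j ≡ adj H i j) → Z G x L U ≈ Z H x L U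
  Z-agree G H x [] U agree = refl
  Z-agree G H x (e@(i , j) ∷ L) U agree = +-cong (Z-agree G H x L U agree)
    (-‿cong (trans (when-≡ ok-agree (Z G x L (U ∖ₑ e)))
       (when-cong (ok H U e) (Z-agree G H x L (U ∖ₑ e) λ k l p q →
         agree k l (lookup-∖⇒ U i (lookup-∖⇒ (U ∖ i) j p)) (lookup-∖⇒ U i (lookup-∖⇒ (U ∖ i) j q))))))
    where
    ok-agree : ok G U e ≡ ok H U e
    ok-agree with lookup U i in p | lookup U j in q
    ... | true | true rewrite agree i j p q = ≡.refl
    ... | true | false = ≡.trans (Bool.∧-zeroʳ _) (≡.sym (Bool.∧-zeroʳ _))
    ... | false | _ = ≡.trans (Bool.∧-zeroʳ _) (≡.sym (Bool.∧-zeroʳ _))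

-- Recursion for the number of matchings of a given size.

∣∖∣ : ∀ {n} (U : Subset n) v → lookup U v ≡ true → ∣ U ∣ ≡ suc ∣ U ∖ v ∣
∣∖∣ (true ∷ U) zero p = ≡.refl
∣∖∣ (true ∷ U) (suc v) p = ≡.cong suc (∣∖∣ U v p)
∣∖∣ (false ∷ U) (suc v) p = ∣∖∣ U v p

ok⇒lookup : ∀ {n} (G : Graph n) U i j → ok G U (i , j) ≡ true →
  i ≢ j × lookup U i ≡ true × lookup U j ≡ true
ok⇒lookup G U i j p with adj G i j in a | lookup U i in q | lookup U j in r
... | true | true | true = (λ { ≡.refl → case-false (≡.trans (≡.sym a) (irrefl G i)) }) , ≡.refl , ≡.refl
  where
  case-false : ¬ (true ≡ false)
  case-false ()

∣∖ₑ∣ : ∀ {n} (G : Graph n) U e → ok G U e ≡ true → ∣ U ∣ ≡ suc (suc ∣ U ∖ₑ e ∣)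
∣∖ₑ∣ G U (i , j) p with ok⇒lookup G U i j p
... | i≢j , q , r = ≡.trans (∣∖∣ U i q) (≡.cong suc (∣∖∣ (U ∖ i) j (≡.trans (lookup-∖-≢ U i≢j) r)))

length-filterᵇ-++ : {A : Set} (p : A → Bool) (xs ys : List A) →
  length (filterᵇ p (xs ++ ys)) ≡ length (filterᵇ p xs) ℕ.+ length (filterᵇ p ys)
length-filterᵇ-++ p [] ys = ≡.refl
length-filterᵇ-++ p (x ∷ xs) ys with p x
... | true = ≡.cong suc (length-filterᵇ-++ p xs ys)
... | false = length-filterᵇ-++ p xs ys

length-filterᵇ-map : {A B : Set} (p : B → Bool) (q : A → Bool) (f : A → B) → (∀ a → p (f a) ≡ q a) → ∀ xs →
  length (filterᵇ p (List.map f xs)) ≡ length (filterᵇ q xs)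
length-filterᵇ-map p q f e [] = ≡.refl
length-filterᵇ-map p q f e (x ∷ xs) with p (f x) | q x | e x
... | true | _ | ≡.refl = ≡.cong suc (length-filterᵇ-map p q f e xs)
... | false | _ | ≡.refl = length-filterᵇ-map p q f e xs

length-filterᵇ-false : {A : Set} (xs : List A) → length (filterᵇ (λ _ → false) xs) ≡ 0
length-filterᵇ-false [] = ≡.refl
length-filterᵇ-false (x ∷ xs) = length-filterᵇ-false xs

allᵇ-∧ : {A : Set} (f g h : A → Bool) → (∀ a → f a ∧ g a ≡ h a) → ∀ xs → allᵇ f xs ∧ allᵇ g xs ≡ allᵇ h xs
allᵇ-∧ f g h e [] = ≡.refl
allᵇ-∧ f g h e (x ∷ xs) = ≡.trans
  (solve 4 (λ a b c d → (a :* b) :* (c :* d) := (a :* c) :* (b :* d)) ≡.refl (f x) _ (g x) _)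
  (≡.cong₂ _∧_ (e x) (allᵇ-∧ f g h e xs))
  where open ∨-∧-Solver

module _ {n} (G : Graph n) where

  -- This is `numMatchings` with `pairs n` generalised to any edge list, to allow induction on the
  -- list.
  matchings : List (Edge n) → Subset n → ℕ → ℕ
  matchings L U r = length (filterᵇ (λ M → isMatchingᵇ G U M ∧ (length M ≡ᵇ r)) (sublists L))

  -- Disjointness from `e` amounts to avoiding its two ends, so that test is absorbed into
  -- admissibility in `U ∖ₑ e`.
  isMatchingᵇ-∷ : ∀ U e M → ok G U e ≡ true → isMatchingᵇ G U (e ∷ M) ≡ isMatchingᵇ G (U ∖ₑ e) M
  isMatchingᵇ-∷ U e@(i , j) M p rewrite p = ≡.trans
    (≡.sym (Bool.∧-assoc (allᵇ _ M) (allᵇ (disjointᵇ e) M) (pairwiseDisjointᵇ M)))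
    (≡.cong (_∧ pairwiseDisjointᵇ M) (allᵇ-∧ _ _ _ avoid M))
    where
    avoid : ∀ f → ok G U f ∧ disjointᵇ e f ≡ ok G (U ∖ₑ e) f
    avoid (k , l)
      rewrite lookup-∖ (U ∖ i) j k | lookup-∖ U i k | lookup-∖ (U ∖ i) j l | lookup-∖ U i l
      with eqᵇ i k | eqᵇ i l | eqᵇ j k | eqᵇ j l
    ... | a | b | c | d = ≡.trans (≡.cong (ok G U (k , l) ∧_) (not-∨₄ a b c d))
      (solve 7 (λ x y z a b c d → (x :* (y :* z)) :* (a :* (b :* (c :* d)))
                 := x :* (((y :* a) :* c) :* ((z :* b) :* d))) ≡.refl
        (adj G k l) (lookup U k) (lookup U l) (not a) (not b) (not c) (not d))
      where
      open ∨-∧-Solver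
      not-∨₄ : ∀ a b c d → not (a ∨ b ∨ c ∨ d) ≡ not a ∧ not b ∧ not c ∧ not d
      not-∨₄ true b c d = ≡.refl
      not-∨₄ false true c d = ≡.refl
      not-∨₄ false false true d = ≡.refl
      not-∨₄ false false false d = ≡.refl

  isMatchingᵇ-∷-false : ∀ U e M → ok G U e ≡ false → isMatchingᵇ G U (e ∷ M) ≡ false
  isMatchingᵇ-∷-false U (i , j) M p rewrite p = ≡.refl

  matchings-0 : ∀ e L U → matchings (e ∷ L) U 0 ≡ matchings L U 0
  matchings-0 e L U = ≡.trans (length-filterᵇ-++ _ (sublists L) _)
    (≡.trans (≡.cong (matchings L U 0 ℕ.+_) (≡.trans
      (length-filterᵇ-map _ (λ _ → false) (e ∷_) (λ M → Bool.∧-zeroʳ (isMatchingᵇ G U (e ∷ M))) (sublists L))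
      (length-filterᵇ-false (sublists L)))) (ℕ.+-identityʳ _))

  matchings-suc : ∀ e L U r → ok G U e ≡ true →
    matchings (e ∷ L) U (suc r) ≡ matchings L U (suc r) ℕ.+ matchings L (U ∖ₑ e) r
  matchings-suc e L U r p = ≡.trans (length-filterᵇ-++ _ (sublists L) _)
    (≡.cong (matchings L U (suc r) ℕ.+_)
      (length-filterᵇ-map _ _ (e ∷_) (λ M → ≡.cong (_∧ (length M ≡ᵇ r)) (isMatchingᵇ-∷ U e M p)) (sublists L)))

  matchings-false : ∀ e L U r → ok G U e ≡ false → matchings (e ∷ L) U r ≡ matchings L U r
  matchings-false e L U r p = ≡.trans (length-filterᵇ-++ _ (sublists L) _)
    (≡.trans (≡.cong (matchings L U r ℕ.+_) (≡.trans
      (length-filterᵇ-map _ (λ _ → false) (e ∷_) (λ M → ≡.cong (_∧ (suc (length M) ≡ᵇ r)) (isMatchingᵇ-∷-false U e M p)) (sublists L))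
      (length-filterᵇ-false (sublists L)))) (ℕ.+-identityʳ _))

-- Expansion of polynomials at `θ`, and multiplicity as order.

module Taylor (ℝ : RealField) (θ : RealField.Carrier ℝ) where
  open RealField ℝ using (Carrier; _≈_; _+_; _*_; -_; 0#; 1#; _≤_)
  open OrderedField ℝ
  open PowerSeries ℝ
  open Poly ℝ
  module ℝSolver = IntegerCoefficientSolver commutativeRing
  module SSolver = IntegerCoefficientSolver seriesRing
  open MatchingSum seriesRing using (weight; Z)
  open FiniteSums seriesRing using (when)
  open import Relation.Binary.Reasoning.Setoid Seriesᵣ.setoid
  open import Algebra.Properties.Ring Seriesᵣ.ring using () renaming (-0#≈0# to -0≋0)

  X : Series
  X = linear θ 1#

  ε : Series
  ε = linear 0# 1#

  -- Horner's rule with `X`, that is `θ` plus the local parameter `ε`, put in place of the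
  -- indeterminate.
  taylor : P → Series
  taylor [] = 0ₛ
  taylor (a ∷ p) = const a ⊞ X ⊛ taylor p

  const-cong : ∀ {a b} → a ≈ b → const a ≋ const b
  const-cong e zero = e
  const-cong e (suc k) = refl

  const-+ : ∀ a b → const (a + b) ≋ const a ⊞ const b
  const-+ a b zero = refl
  const-+ a b (suc k) = sym (+-identityˡ 0#)

  const-* : ∀ a b → const (a * b) ≋ const a ⊛ const b
  const-* a b zero = refl
  const-* a b (suc k) = sym (trans (const-⊛ a (const b) (suc k)) (zeroʳ a))

  const-0 : const 0# ≋ 0ₛ
  const-0 zero = refl
  const-0 (suc k) = refl

  taylor-+ₚ : ∀ p q → taylor (p +ₚ q) ≋ taylor p ⊞ taylor q
  taylor-+ₚ [] q = Seriesᵣ.sym (Seriesᵣ.+-identityˡ (taylor q))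
  taylor-+ₚ (a ∷ p) [] = Seriesᵣ.sym (Seriesᵣ.+-identityʳ (taylor (a ∷ p)))
  taylor-+ₚ (a ∷ p) (b ∷ q) = begin
    const (a + b) ⊞ X ⊛ taylor (p +ₚ q)
      ≈⟨ Seriesᵣ.+-cong (const-+ a b) (Seriesᵣ.*-congˡ (taylor-+ₚ p q)) ⟩
    (const a ⊞ const b) ⊞ X ⊛ (taylor p ⊞ taylor q)
      ≈⟨ solve 5 (λ a b x p q → (a :+ b) :+ x :* (p :+ q) := (a :+ x :* p) :+ (b :+ x :* q)) Seriesᵣ.refl (const a) (const b) X (taylor p) (taylor q) ⟩
    taylor (a ∷ p) ⊞ taylor (b ∷ q) ∎
    where open SSolver

  taylor-map : ∀ c p → taylor (List.map (c *_) p) ≋ const c ⊛ taylor p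
  taylor-map c [] = Seriesᵣ.sym (Seriesᵣ.zeroʳ (const c))
  taylor-map c (a ∷ p) = begin
    const (c * a) ⊞ X ⊛ taylor (List.map (c *_) p)
      ≈⟨ Seriesᵣ.+-cong (const-* c a) (Seriesᵣ.*-congˡ (taylor-map c p)) ⟩
    const c ⊛ const a ⊞ X ⊛ (const c ⊛ taylor p)
      ≈⟨ solve 4 (λ c a x p → c :* a :+ x :* (c :* p) := c :* (a :+ x :* p)) Seriesᵣ.refl (const c) (const a) X (taylor p) ⟩
    const c ⊛ taylor (a ∷ p) ∎
    where open SSolver

  taylor-0∷ : ∀ p → taylor (0# ∷ p) ≋ X ⊛ taylor p
  taylor-0∷ p = Seriesᵣ.trans (Seriesᵣ.+-congʳ const-0) (Seriesᵣ.+-identityˡ _)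

  taylor-*ₚ : ∀ p q → taylor (p *ₚ q) ≋ taylor p ⊛ taylor q
  taylor-*ₚ [] q = Seriesᵣ.sym (Seriesᵣ.zeroˡ (taylor q))
  taylor-*ₚ (a ∷ p) q = begin
    taylor (List.map (a *_) q +ₚ (0# ∷ (p *ₚ q)))
      ≈⟨ taylor-+ₚ (List.map (a *_) q) (0# ∷ (p *ₚ q)) ⟩
    taylor (List.map (a *_) q) ⊞ taylor (0# ∷ (p *ₚ q))
      ≈⟨ Seriesᵣ.+-cong (taylor-map a q) (Seriesᵣ.trans (taylor-0∷ (p *ₚ q)) (Seriesᵣ.*-congˡ (taylor-*ₚ p q))) ⟩
    const a ⊛ taylor q ⊞ X ⊛ (taylor p ⊛ taylor q)
      ≈⟨ solve 4 (λ a q x p → a :* q :+ x :* (p :* q) := (a :+ x :* p) :* q) Seriesᵣ.refl (const a) (taylor q) X (taylor p) ⟩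
    taylor (a ∷ p) ⊛ taylor q ∎
    where open SSolver

  taylor-cong : ∀ p q → p ≈ₚ q → taylor p ≋ taylor q
  taylor-cong [] [] e = Seriesᵣ.refl
  taylor-cong [] (b ∷ q) e = Seriesᵣ.sym (Seriesᵣ.trans
    (Seriesᵣ.+-cong (Seriesᵣ.trans (const-cong (sym (e 0))) const-0)
      (Seriesᵣ.*-congˡ (Seriesᵣ.sym (taylor-cong [] q (e ∘ suc)))))
    (Seriesᵣ.trans (Seriesᵣ.+-identityˡ _) (Seriesᵣ.zeroʳ X)))
  taylor-cong (a ∷ p) [] e = Seriesᵣ.trans
    (Seriesᵣ.+-cong (Seriesᵣ.trans (const-cong (e 0)) const-0)
      (Seriesᵣ.*-congˡ (taylor-cong p [] (e ∘ suc))))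
    (Seriesᵣ.trans (Seriesᵣ.+-identityˡ _) (Seriesᵣ.zeroʳ X))
  taylor-cong (a ∷ p) (b ∷ q) e = Seriesᵣ.+-cong (const-cong (e 0)) (Seriesᵣ.*-congˡ (taylor-cong p q (e ∘ suc)))

  taylor-eval : ∀ p → taylor p 0 ≈ eval p θ
  taylor-eval [] = refl
  taylor-eval (a ∷ p) = +-congˡ (*-congˡ (taylor-eval p))

  taylor-1 : taylor (1# ∷ []) ≋ const 1#
  taylor-1 = Seriesᵣ.trans (Seriesᵣ.+-congˡ (Seriesᵣ.zeroʳ X)) (Seriesᵣ.+-identityʳ _)

  taylor-X- : taylor (X- θ) ≋ ε
  taylor-X- = Seriesᵣ.trans (Seriesᵣ.+-congˡ (Seriesᵣ.trans (Seriesᵣ.*-congˡ taylor-1) (Seriesᵣ.*-identityʳ X))) e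
    where
    e : const (- θ) ⊞ X ≋ ε
    e zero = -‿inverseˡ θ
    e (suc zero) = +-identityˡ 1#
    e (suc (suc k)) = +-identityˡ 0#

  ε⊛-0 : ∀ s → (ε ⊛ s) 0 ≈ 0#
  ε⊛-0 s = zeroˡ _

  ε⊛-suc : ∀ s k → (ε ⊛ s) (suc k) ≈ s k
  ε⊛-suc s k = trans (linear₁-⊛-suc 0# s k) (trans (+-congʳ (zeroˡ _)) (+-identityˡ _))

  Van-ε⊛ : ∀ {s m} → Van s m → Van (ε ⊛ s) (suc m)
  Van-ε⊛ {s} v zero _ = ε⊛-0 s
  Van-ε⊛ {s} v (suc j) (s≤s j<m) = trans (ε⊛-suc s j) (v j j<m)

  HasOrder-ε⊛ : ∀ {s m} → HasOrder s m → HasOrder (ε ⊛ s) (suc m)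
  HasOrder-ε⊛ {s} {m} (v , ≉0) = Van-ε⊛ v , λ e → ≉0 (trans (sym (ε⊛-suc s m)) e)

  HasOrder-ε⊛⁻¹ : ∀ {s m} → HasOrder (ε ⊛ s) (suc m) → HasOrder s m
  HasOrder-ε⊛⁻¹ {s} {m} (v , ≉0) = (λ j j<m → trans (sym (ε⊛-suc s j)) (v (suc j) (s≤s j<m)))
    , λ e → ≉0 (trans (ε⊛-suc s m) e)

  taylor-X-^suc : ∀ k q → taylor (((X- θ) ^ₚ suc k) *ₚ q) ≋ ε ⊛ taylor (((X- θ) ^ₚ k) *ₚ q)
  taylor-X-^suc k q = begin
    taylor (((X- θ) *ₚ ((X- θ) ^ₚ k)) *ₚ q)               ≈⟨ taylor-*ₚ ((X- θ) *ₚ ((X- θ) ^ₚ k)) q ⟩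
    taylor ((X- θ) *ₚ ((X- θ) ^ₚ k)) ⊛ taylor q           ≈⟨ Seriesᵣ.*-congʳ (Seriesᵣ.trans (taylor-*ₚ (X- θ) ((X- θ) ^ₚ k)) (Seriesᵣ.*-congʳ taylor-X-)) ⟩
    (ε ⊛ taylor ((X- θ) ^ₚ k)) ⊛ taylor q                 ≈⟨ Seriesᵣ.*-assoc _ _ _ ⟩
    ε ⊛ (taylor ((X- θ) ^ₚ k) ⊛ taylor q)                 ≈⟨ Seriesᵣ.*-congˡ (taylor-*ₚ ((X- θ) ^ₚ k) q) ⟨
    ε ⊛ taylor (((X- θ) ^ₚ k) *ₚ q)                       ∎

  -- Expansion turns each factor `X- θ` into `ε`, a shift by one place, and the cofactor `q` into a
  -- series with nonzero constant term.
  IsMult⇒HasOrder : ∀ k p → IsMult θ p k → HasOrder (taylor p) k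
  IsMult⇒HasOrder k p (q , e , q≉0) = HasOrder-≋ (Seriesᵣ.sym (taylor-cong p (((X- θ) ^ₚ k) *ₚ q) e)) (go k)
    where
    go : ∀ k → HasOrder (taylor (((X- θ) ^ₚ k) *ₚ q)) k
    go zero = HasOrder-≋
      (Seriesᵣ.sym (Seriesᵣ.trans (taylor-*ₚ (1# ∷ []) q) (Seriesᵣ.trans (Seriesᵣ.*-congʳ taylor-1) (Seriesᵣ.*-identityˡ _))))
      ((λ _ ()) , λ e → q≉0 (trans (sym (taylor-eval q)) e))
    go (suc k) = HasOrder-≋ (Seriesᵣ.sym (taylor-X-^suc k q)) (HasOrder-ε⊛ (go k))

  coeff-+ₚ : ∀ p q → coeff (p +ₚ q) ≋ coeff p ⊞ coeff q
  coeff-+ₚ [] q k = sym (+-identityˡ _)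
  coeff-+ₚ (a ∷ p) [] k = sym (+-identityʳ _)
  coeff-+ₚ (a ∷ p) (b ∷ q) zero = refl
  coeff-+ₚ (a ∷ p) (b ∷ q) (suc k) = coeff-+ₚ p q k

  coeff-map : ∀ c p → coeff (List.map (c *_) p) ≋ scale c (coeff p)
  coeff-map c [] k = sym (zeroʳ c)
  coeff-map c (a ∷ p) zero = refl
  coeff-map c (a ∷ p) (suc k) = coeff-map c p k

  -- Coefficient lists are thereby also series, expanded at zero. The coefficientwise equality
  -- inside `IsMult` can then be proved with the ring laws of `⊛`.
  coeff-*ₚ : ∀ p q → coeff (p *ₚ q) ≋ coeff p ⊛ coeff q
  coeff-*ₚ [] q = Seriesᵣ.sym (0⊛ (coeff q))
  coeff-*ₚ (a ∷ p) q zero = trans (coeff-+ₚ (List.map (a *_) q) _ 0) (trans (+-identityʳ _) (coeff-map a q 0))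
  coeff-*ₚ (a ∷ p) q (suc k) = trans (coeff-+ₚ (List.map (a *_) q) _ (suc k)) (+-cong (coeff-map a q (suc k)) (coeff-*ₚ p q k))

  -- Horner's scheme.
  quotient : P → P
  quotient [] = []
  quotient (a ∷ p) = eval p θ ∷ quotient p

  coeff-X- : coeff (X- θ) ≋ linear (- θ) 1#
  coeff-X- zero = refl
  coeff-X- (suc zero) = refl
  coeff-X- (suc (suc k)) = refl

  quotient-remainder : ∀ p → coeff p ≋ const (eval p θ) ⊞ linear (- θ) 1# ⊛ coeff (quotient p)
  quotient-remainder [] = Seriesᵣ.sym (Seriesᵣ.trans (Seriesᵣ.+-cong const-0 (Seriesᵣ.zeroʳ _)) (Seriesᵣ.+-identityˡ _))
  quotient-remainder (a ∷ p) zero = solve 3 (λ a t e → a := a :+ t :* e :+ (:- t) :* e) refl a θ (eval p θ)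
    where open ℝSolver
  quotient-remainder (a ∷ p) (suc zero) = trans (quotient-remainder p 0) (trans (+-comm _ _)
    (trans (sym (linear₁-⊛-suc (- θ) (coeff (quotient (a ∷ p))) 0)) (sym (+-identityˡ _))))
  quotient-remainder (a ∷ p) (suc (suc k)) = trans (quotient-remainder p (suc k))
    (+-congˡ (trans (linear₁-⊛-suc (- θ) (coeff (quotient p)) k)
      (sym (linear₁-⊛-suc (- θ) (coeff (quotient (a ∷ p))) (suc k)))))

  root⇒factor : ∀ p → eval p θ ≈ 0# → p ≈ₚ ((X- θ) *ₚ quotient p)
  root⇒factor p e = Seriesᵣ.trans (quotient-remainder p) (Seriesᵣ.trans
    (Seriesᵣ.+-cong (Seriesᵣ.trans (const-cong e) const-0) (⊛-cong (Seriesᵣ.sym coeff-X-) (Seriesᵣ.refl {coeff (quotient p)})))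
    (Seriesᵣ.trans (Seriesᵣ.+-identityˡ _) (Seriesᵣ.sym (coeff-*ₚ (X- θ) (quotient p)))))

  taylor-factor : ∀ p → eval p θ ≈ 0# → taylor p ≋ ε ⊛ taylor (quotient p)
  taylor-factor p root = begin
    taylor p                               ≈⟨ taylor-cong p ((X- θ) *ₚ quotient p) (root⇒factor p root) ⟩
    taylor ((X- θ) *ₚ quotient p)          ≈⟨ taylor-*ₚ (X- θ) (quotient p) ⟩
    taylor (X- θ) ⊛ taylor (quotient p)    ≈⟨ ⊛-cong {taylor (X- θ)} {ε} {taylor (quotient p)} taylor-X- (λ _ → refl) ⟩
    ε ⊛ taylor (quotient p)                ∎

  -- Positive order makes `θ` a root; splitting off one linear factor lowers the order by one, and
  -- induction treats the quotient.
  HasOrder⇒IsMult : ∀ k p → HasOrder (taylor p) k → IsMult θ p k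
  HasOrder⇒IsMult zero p (_ , ≉0) = p
    , Seriesᵣ.sym (Seriesᵣ.trans (coeff-*ₚ (1# ∷ []) p) (Seriesᵣ.trans (Seriesᵣ.*-congʳ coeff-1) (Seriesᵣ.*-identityˡ _)))
    , λ e → ≉0 (trans (taylor-eval p) e)
    where
    coeff-1 : coeff (1# ∷ []) ≋ const 1#
    coeff-1 zero = refl
    coeff-1 (suc k) = refl
  HasOrder⇒IsMult (suc k) p o@(v , _) =
    IsMult-suc (HasOrder⇒IsMult k (quotient p) (HasOrder-ε⊛⁻¹ (HasOrder-≋ (taylor-factor p root) o)))
    where
    root : eval p θ ≈ 0#
    root = trans (sym (taylor-eval p)) (v 0 (s≤s z≤n))
    IsMult-suc : IsMult θ (quotient p) k → IsMult θ p (suc k)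
    IsMult-suc (q , e , q≉0) = q , split , q≉0
      where
      c = coeff (X- θ)
      d = coeff ((X- θ) ^ₚ k)
      split : coeff p ≋ coeff (((X- θ) ^ₚ suc k) *ₚ q)
      split = begin
        coeff p                                     ≈⟨ root⇒factor p root ⟩
        coeff ((X- θ) *ₚ quotient p)                ≈⟨ coeff-*ₚ (X- θ) (quotient p) ⟩
        c ⊛ coeff (quotient p)                      ≈⟨ ⊛-cong {c} {c} {coeff (quotient p)} {d ⊛ coeff q} (λ _ → refl) (λ j → trans (e j) (coeff-*ₚ ((X- θ) ^ₚ k) q j)) ⟩
        c ⊛ (d ⊛ coeff q)                           ≈⟨ ⊛-assoc c d (coeff q) ⟨
        (c ⊛ d) ⊛ coeff q                           ≈⟨ ⊛-cong {s′ = c ⊛ d} {t = coeff q} (coeff-*ₚ (X- θ) ((X- θ) ^ₚ k)) (λ _ → refl) ⟨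
        coeff ((X- θ) ^ₚ suc k) ⊛ coeff q           ≈⟨ coeff-*ₚ ((X- θ) ^ₚ suc k) q ⟨
        coeff (((X- θ) ^ₚ suc k) *ₚ q)              ∎

  pow : ℕ → Series
  pow zero = const 1#
  pow (suc k) = X ⊛ pow k

  weight-X : ∀ {n} (U : Subset n) → weight (λ _ → X) U ≋ pow ∣ U ∣
  weight-X [] = Seriesᵣ.refl
  weight-X (true ∷ U) = Seriesᵣ.*-congˡ {X} (weight-X U)
  weight-X (false ∷ U) = weight-X U

  taylor-monomial : ∀ c k → taylor (monomial c k) ≋ const c ⊛ pow k
  taylor-monomial c zero = Seriesᵣ.trans (Seriesᵣ.+-congˡ (Seriesᵣ.zeroʳ X))
    (Seriesᵣ.trans (Seriesᵣ.+-identityʳ _) (Seriesᵣ.sym (Seriesᵣ.*-identityʳ (const c))))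
  taylor-monomial c (suc k) = Seriesᵣ.trans (taylor-0∷ (monomial c k)) (Seriesᵣ.trans (Seriesᵣ.*-congˡ {X} (taylor-monomial c k))
    (solve 3 (λ x c p → x :* (c :* p) := c :* (x :* p)) Seriesᵣ.refl X (const c) (pow k)))
    where open SSolver

  fromℕ-+ : ∀ a b → fromℕ (a ℕ.+ b) ≈ fromℕ a + fromℕ b
  fromℕ-+ zero b = sym (+-identityˡ _)
  fromℕ-+ (suc a) b = trans (+-congˡ (fromℕ-+ a b)) (sym (+-assoc _ _ _))

  -- The contribution to μ of c matchings of size r in a graph with m vertices.
  term : ℕ → ℕ → ℕ → P
  term m r c = if (r ℕ.+ r) ≤ᵇ m then monomial (sign r * fromℕ c) (m ∸ (r ℕ.+ r)) else []

  term-0 : ∀ m r → taylor (term m r 0) ≋ 0ₛ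
  term-0 m r with (r ℕ.+ r) ≤ᵇ m
  ... | false = Seriesᵣ.refl
  ... | true = Seriesᵣ.trans (taylor-monomial _ (m ∸ (r ℕ.+ r)))
    (Seriesᵣ.trans (Seriesᵣ.*-congʳ (Seriesᵣ.trans (const-cong (zeroʳ (sign r))) const-0)) (Seriesᵣ.zeroˡ _))

  term-+ : ∀ m r c d → taylor (term m r (c ℕ.+ d)) ≋ taylor (term m r c) ⊞ taylor (term m r d)
  term-+ m r c d with (r ℕ.+ r) ≤ᵇ m
  ... | false = Seriesᵣ.sym (Seriesᵣ.+-identityˡ 0ₛ)
  ... | true = begin
    taylor (monomial (sign r * fromℕ (c ℕ.+ d)) k)
      ≈⟨ taylor-monomial _ k ⟩
    const (sign r * fromℕ (c ℕ.+ d)) ⊛ pow k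
      ≈⟨ Seriesᵣ.*-congʳ (Seriesᵣ.trans (const-cong (trans (*-congˡ (fromℕ-+ c d)) (distribˡ _ _ _))) (const-+ _ _)) ⟩
    (const (sign r * fromℕ c) ⊞ const (sign r * fromℕ d)) ⊛ pow k
      ≈⟨ Seriesᵣ.distribʳ (pow k) _ _ ⟩
    const (sign r * fromℕ c) ⊛ pow k ⊞ const (sign r * fromℕ d) ⊛ pow k
      ≈⟨ Seriesᵣ.+-cong (taylor-monomial _ k) (taylor-monomial _ k) ⟨
    taylor (monomial (sign r * fromℕ c) k) ⊞ taylor (monomial (sign r * fromℕ d) k) ∎
    where k = m ∸ (r ℕ.+ r)

  <ᵇ-suc : ∀ a b → (a <ᵇ suc b) ≡ (a ≤ᵇ b)
  <ᵇ-suc zero b = ≡.refl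
  <ᵇ-suc (suc a) b = ≡.refl

  -- One more edge covers two more vertices: the exponent is unchanged and the sign flips.
  term-suc : ∀ m r c → taylor (term (suc (suc m)) (suc r) c) ≋ Seriesᵣ.- taylor (term m r c)
  term-suc m r c rewrite ℕ.+-suc r r | <ᵇ-suc (r ℕ.+ r) m with (r ℕ.+ r) ≤ᵇ m
  ... | false = Seriesᵣ.sym -0≋0
  ... | true = begin
    taylor (monomial (- sign r * fromℕ c) k)
      ≈⟨ taylor-monomial _ k ⟩
    const (- sign r * fromℕ c) ⊛ pow k
      ≈⟨ Seriesᵣ.*-congʳ (Seriesᵣ.trans (const-cong (sym (-‿distribˡ-* _ _))) const-neg) ⟩
    (Seriesᵣ.- const (sign r * fromℕ c)) ⊛ pow k
      ≈⟨ solve 2 (λ a b → (:- a) :* b := :- (a :* b)) Seriesᵣ.refl (const (sign r * fromℕ c)) (pow k) ⟩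
    Seriesᵣ.- (const (sign r * fromℕ c) ⊛ pow k)
      ≈⟨ Seriesᵣ.-‿cong (taylor-monomial _ k) ⟨
    Seriesᵣ.- taylor (monomial (sign r * fromℕ c) k) ∎
    where
    open SSolver
    k = m ∸ (r ℕ.+ r)
    const-neg : ∀ {a} → const (- a) ≋ Seriesᵣ.- const a
    const-neg zero = refl
    const-neg (suc k) = sym -0#≈0#

  sumTo : ℕ → (ℕ → Series) → Series
  sumTo zero h = 0ₛ
  sumTo (suc N) h = h 0 ⊞ sumTo N (h ∘ suc)

  sumTo-cong : ∀ N {g h} → (∀ r → g r ≋ h r) → sumTo N g ≋ sumTo N h
  sumTo-cong zero e = Seriesᵣ.refl
  sumTo-cong (suc N) e = Seriesᵣ.+-cong (e 0) (sumTo-cong N (e ∘ suc))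

  sumTo-0 : ∀ N {g} → (∀ r → g r ≋ 0ₛ) → sumTo N g ≋ 0ₛ
  sumTo-0 zero e = Seriesᵣ.refl
  sumTo-0 (suc N) e = Seriesᵣ.trans (Seriesᵣ.+-cong (e 0) (sumTo-0 N (e ∘ suc))) (Seriesᵣ.+-identityˡ 0ₛ)

  sumTo-- : ∀ N g h → sumTo N (λ r → g r ⊞ Seriesᵣ.- h r) ≋ sumTo N g Seriesᵣ.- sumTo N h
  sumTo-- zero g h = Seriesᵣ.sym (Seriesᵣ.-‿inverseʳ 0ₛ)
  sumTo-- (suc N) g h = Seriesᵣ.trans (Seriesᵣ.+-congˡ (sumTo-- N (g ∘ suc) (h ∘ suc)))
    (solve 4 (λ a b c d → (a :- b) :+ (c :- d) := (a :+ c) :- (b :+ d)) Seriesᵣ.refl (g 0) (h 0) (sumTo N (g ∘ suc)) (sumTo N (h ∘ suc)))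
    where open SSolver

  taylor-foldr : ∀ (g : ℕ → P) f N →
    taylor (List.foldr _+ₚ_ [] (List.map g (applyUpTo f N))) ≋ sumTo N (λ r → taylor (g (f r)))
  taylor-foldr g f zero = Seriesᵣ.refl
  taylor-foldr g f (suc N) = Seriesᵣ.trans (taylor-+ₚ (g (f 0)) _) (Seriesᵣ.+-congˡ (taylor-foldr g (f ∘ suc) N))

  module _ {n} (G : Graph n) where

    -- Any range `N` above `∣ U ∣` is allowed, because the recursive call on `U ∖ₑ e` shortens the
    -- range by one while the vertex count drops by two. Surplus terms vanish.
    sumTo-matchings : ∀ N L U → ∣ U ∣ ℕ.< N →
      sumTo N (λ r → taylor (term ∣ U ∣ r (matchings G L U r))) ≋ Z G (λ _ → X) L U
    sumTo-matchings (suc N) [] U _ = begin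
      taylor (monomial (1# * (1# + 0#)) ∣ U ∣) ⊞ sumTo N (λ r → taylor (term ∣ U ∣ (suc r) 0))
        ≈⟨ Seriesᵣ.+-cong (taylor-monomial _ ∣ U ∣) (sumTo-0 N (λ r → term-0 ∣ U ∣ (suc r))) ⟩
      const (1# * (1# + 0#)) ⊛ pow ∣ U ∣ ⊞ 0ₛ
        ≈⟨ Seriesᵣ.+-identityʳ _ ⟩
      const (1# * (1# + 0#)) ⊛ pow ∣ U ∣
        ≈⟨ Seriesᵣ.*-congʳ (const-cong (trans (*-identityˡ _) (+-identityʳ 1#))) ⟩
      const 1# ⊛ pow ∣ U ∣
        ≈⟨ Seriesᵣ.*-identityˡ _ ⟩
      pow ∣ U ∣
        ≈⟨ weight-X U ⟨
      weight (λ _ → X) U ∎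
    sumTo-matchings (suc N) (e ∷ L) U U<N with ok G U e in p
    ... | false = Seriesᵣ.trans
      (sumTo-cong (suc N) (λ r → Seriesᵣ.reflexive (≡.cong (taylor ∘ term ∣ U ∣ r) (matchings-false G e L U r p))))
      (Seriesᵣ.trans (sumTo-matchings (suc N) L U U<N) (solve 1 (λ a → a := a :- :0) Seriesᵣ.refl _))
      where open SSolver
    ... | true = begin
      τ 0 (matchings G (e ∷ L) U 0) ⊞ sumTo N (λ r → τ (suc r) (matchings G (e ∷ L) U (suc r)))
        ≈⟨ Seriesᵣ.+-cong (Seriesᵣ.reflexive (≡.cong (τ 0) (matchings-0 G e L U))) (sumTo-cong N split) ⟩
      τ 0 (matchings G L U 0) ⊞ sumTo N (λ r → τ (suc r) (matchings G L U (suc r)) ⊞ Seriesᵣ.- τ′ r)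
        ≈⟨ Seriesᵣ.+-congˡ (sumTo-- N (λ r → τ (suc r) (matchings G L U (suc r))) τ′) ⟩
      τ 0 (matchings G L U 0) ⊞ (sumTo N (λ r → τ (suc r) (matchings G L U (suc r))) Seriesᵣ.- sumTo N τ′)
        ≈⟨ Seriesᵣ.+-assoc _ _ _ ⟨
      sumTo (suc N) (λ r → τ r (matchings G L U r)) Seriesᵣ.- sumTo N τ′
        ≈⟨ Seriesᵣ.+-cong (sumTo-matchings (suc N) L U U<N) (Seriesᵣ.-‿cong (sumTo-matchings N L (U ∖ₑ e) U∖e<N)) ⟩
      Z G (λ _ → X) L U Seriesᵣ.- Z G (λ _ → X) L (U ∖ₑ e) ∎
      where
      τ : ℕ → ℕ → Series
      τ r c = taylor (term ∣ U ∣ r c)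
      τ′ : ℕ → Series
      τ′ r = taylor (term ∣ U ∖ₑ e ∣ r (matchings G L (U ∖ₑ e) r))
      ∣U∣ : ∣ U ∣ ≡ suc (suc ∣ U ∖ₑ e ∣)
      ∣U∣ = ∣∖ₑ∣ G U e p
      U∖e<N : ∣ U ∖ₑ e ∣ ℕ.< N
      U∖e<N = ℕ.≤-pred (ℕ.≤-trans (ℕ.≤-trans (ℕ.≤-reflexive (≡.sym ∣U∣)) (ℕ.n≤1+n _)) U<N)
      split : ∀ r → τ (suc r) (matchings G (e ∷ L) U (suc r)) ≋ τ (suc r) (matchings G L U (suc r)) ⊞ Seriesᵣ.- τ′ r
      split r = Seriesᵣ.trans (Seriesᵣ.reflexive (≡.cong (τ (suc r)) (matchings-suc G e L U r p)))
        (Seriesᵣ.trans (term-+ ∣ U ∣ (suc r) (matchings G L U (suc r)) (matchings G L (U ∖ₑ e) r))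
          (Seriesᵣ.+-congˡ (Seriesᵣ.trans
            (Seriesᵣ.reflexive (≡.cong (λ m → taylor (term m (suc r) (matchings G L (U ∖ₑ e) r))) ∣U∣))
            (term-suc ∣ U ∖ₑ e ∣ r (matchings G L (U ∖ₑ e) r)))))

    -- The bridge from the polynomial of the statement to `Z` with every weight equal to `X`.
    taylor-μ : ∀ U → taylor μ[ G , U ] ≋ Z G (λ _ → X) (pairs n) U
    taylor-μ U = Seriesᵣ.trans (taylor-foldr (λ r → term ∣ U ∣ r (numMatchings G U r)) id (suc ∣ U ∣))
      (sumTo-matchings (suc ∣ U ∣) (pairs n) U ℕ.≤-refl)

-- Order, sign and nonvanishing of finite sums of series.

module SeriesSums (ℝ : RealField) where
  open RealField ℝ using (Carrier; _≈_; _+_; _*_; -_; 0#; 1#; _≤_)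
  open OrderedField ℝ
  open PowerSeries ℝ
  open FiniteSums seriesRing

  Van-sum : ∀ {n} (f : Fin n → Series) {k} → (∀ i → Van (f i) k) → Van (sum f) k
  Van-sum {zero} f v j j<k = refl
  Van-sum {suc n} f v = Van-⊞ (v zero) (Van-sum (f ∘ suc) (v ∘ suc))

  Van-when : ∀ b {s k} → (b ≡ true → Van s k) → Van (when b s) k
  Van-when true v = v ≡.refl
  Van-when false v j j<k = refl

  NonNeg-when : ∀ b {s} → (b ≡ true → NonNeg s) → NonNeg (when b s)
  NonNeg-when true ns = ns ≡.refl
  NonNeg-when false ns = NonNeg-0

  NonNeg-sum : ∀ {n} (f : Fin n → Series) → (∀ i → NonNeg (f i)) → NonNeg (sum f)
  NonNeg-sum {zero} f nf = NonNeg-0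
  NonNeg-sum {suc n} f nf = NonNeg-⊞ (nf zero) (NonNeg-sum (f ∘ suc) (nf ∘ suc))

  NonNeg-sum-Van : ∀ {n} (f : Fin n → Series) {k} → (∀ i → NonNeg (f i)) → Van (sum f) k → ∀ i → Van (f i) k
  NonNeg-sum-Van {suc n} f {k} nf v i with NonNeg-split k (nf zero) (NonNeg-sum (f ∘ suc) (nf ∘ suc)) v
  NonNeg-sum-Van {suc n} f nf v zero | v₀ , vs = v₀
  NonNeg-sum-Van {suc n} f nf v (suc i) | v₀ , vs = NonNeg-sum-Van (f ∘ suc) (nf ∘ suc) vs i

  -- The factor `h` stands for a leading coefficient whose sign is unknown; nonnegative products
  -- with it express that all terms agree with it in sign.
  0≤-sum : ∀ {n} h (f : Fin n → Series) k → (∀ i → 0# ≤ h * f i k) → 0# ≤ h * sum f k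
  0≤-sum {zero} h f k p = ≤-reflexive (sym (zeroʳ h))
  0≤-sum {suc n} h f k p = ≤-respʳ-≈ (sym (distribˡ h _ _)) (0≤-+ (p zero) (0≤-sum h (f ∘ suc) k (p ∘ suc)))

  sum≈0⇒≈0 : ∀ {n} h (f : Fin n → Series) k → (∀ i → 0# ≤ h * f i k) → h * sum f k ≈ 0# → ∀ i → h * f i k ≈ 0#
  sum≈0⇒≈0 {suc n} h f k p e i
    with 0≤∧0≤∧+≈0⇒≈0 (p zero) (0≤-sum h (f ∘ suc) k (p ∘ suc)) (trans (sym (distribˡ h _ _)) e)
  sum≈0⇒≈0 {suc n} h f k p e zero | e₀ , es = e₀
  sum≈0⇒≈0 {suc n} h f k p e (suc i) | e₀ , es = sum≈0⇒≈0 h (f ∘ suc) k (p ∘ suc) es i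

  sum≉0⇒∃ : ∀ {n} (f : Fin n → Series) k → ¬ (sum f k ≈ 0#) → ∃[ i ] ¬ (f i k ≈ 0#)
  sum≉0⇒∃ {zero} f k ≉0 = ⊥-elim (≉0 refl)
  sum≉0⇒∃ {suc n} f k ≉0 with f zero k ≈0?
  ... | no p = zero , p
  ... | yes p with sum≉0⇒∃ (f ∘ suc) k (λ e → ≉0 (trans (+-cong p e) (+-identityˡ 0#)))
  ...   | i , q = suc i , q

  when≉0 : ∀ b {s : Series} {k} → ¬ (when b s k ≈ 0#) → b ≡ true × ¬ (s k ≈ 0#)
  when≉0 true p = ≡.refl , p
  when≉0 false p = ⊥-elim (p refl)

-- Nonnegativity of the differences `Δ` for arbitrary weights.

module Rayleigh (ℝ : RealField) {n} (G : Graph n) (x : Fin n → PowerSeries.Series ℝ) where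
  open PowerSeries ℝ
  open FiniteSums seriesRing
  open SeriesSums ℝ
  open MatchingSum seriesRing
  open Seriesᵣ using () renaming (_-_ to _⊟_)
  open import Relation.Binary.Reasoning.Setoid Seriesᵣ.setoid
  open IntegerCoefficientSolver seriesRing using (solve; _:=_; _:+_; _:*_; _:-_; :-_; :0)

  F : Subset n → Series
  F = Z G x (pairs n)

  F-≡ : ∀ {U V} → U ≡ V → F U ≋ F V
  F-≡ = Z-≡ G x (pairs n)

  Δ : Subset n → Fin n → Fin n → Series
  Δ U u v = F (U ∖ u) ⊛ F (U ∖ v) ⊟ F U ⊛ F (U ∖ u ∖ v)

  -- `F U` and `F (U ∖ v)` are both expanded at `u`; the two products containing `x u` coincide and
  -- cancel, whatever the weights are.
  Δ-expand : ∀ U u v → u ≢ v → lookup U u ≡ true → Δ U u v ≋ sum (λ w →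
      when (adj G u w ∧ lookup U w) (F (U ∖ u ∖ w)) ⊛ F (U ∖ u ∖ v)
    ⊟ F (U ∖ u) ⊛ when (adj G u w ∧ lookup (U ∖ v) w) (F (U ∖ u ∖ v ∖ w)))
  Δ-expand U u v u≢v p = begin
    F (U ∖ u) ⊛ F (U ∖ v) ⊟ F U ⊛ F (U ∖ u ∖ v)
      ≈⟨ Seriesᵣ.+-cong (⊛-cong {F (U ∖ u)} {F (U ∖ u)} {F (U ∖ v)} Seriesᵣ.refl FU∖v)
           (Seriesᵣ.-‿cong (⊛-cong {F U} {_} {F (U ∖ u ∖ v)} (Z-vertex G x U u p) Seriesᵣ.refl)) ⟩
    F (U ∖ u) ⊛ (x u ⊛ F (U ∖ u ∖ v) ⊟ S₂) ⊟ (x u ⊛ F (U ∖ u) ⊟ S₁) ⊛ F (U ∖ u ∖ v)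
      ≈⟨ solve 5 (λ m x b s t → m :* (x :* b :- t) :- (x :* m :- s) :* b := s :* b :- m :* t) Seriesᵣ.refl
           (F (U ∖ u)) (x u) (F (U ∖ u ∖ v)) S₁ S₂ ⟩
    S₁ ⊛ F (U ∖ u ∖ v) ⊟ F (U ∖ u) ⊛ S₂
      ≈⟨ Seriesᵣ.+-cong (*-distribʳ-sum {n} (F (U ∖ u ∖ v)) f₁) (Seriesᵣ.-‿cong (*-distribˡ-sum {n} (F (U ∖ u)) f₂)) ⟩
    sum (λ w → f₁ w ⊛ F (U ∖ u ∖ v)) ⊟ sum (λ w → F (U ∖ u) ⊛ f₂ w)
      ≈⟨ sum-- {n} (λ w → f₁ w ⊛ F (U ∖ u ∖ v)) (λ w → F (U ∖ u) ⊛ f₂ w) ⟨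
    sum (λ w → f₁ w ⊛ F (U ∖ u ∖ v) ⊟ F (U ∖ u) ⊛ f₂ w) ∎
    where
    f₁ f₂ : Fin n → Series
    f₁ w = when (adj G u w ∧ lookup U w) (F (U ∖ u ∖ w))
    f₂ w = when (adj G u w ∧ lookup (U ∖ v) w) (F (U ∖ u ∖ v ∖ w))
    S₁ S₂ : Series
    S₁ = sum f₁
    S₂ = sum f₂
    FU∖v : F (U ∖ v) ≋ x u ⊛ F (U ∖ u ∖ v) ⊟ S₂
    FU∖v rewrite ∖-comm U u v = Z-vertex G x (U ∖ v) u (≡.trans (lookup-∖-≢ U (u≢v ∘ ≡.sym)) p)

  -- Induction on the number of vertices, bounded by `N`. In the expansion at `u` the neighbour `v`,
  -- if it is one, contributes a square, and every other neighbour `w` contributes `Δ (U ∖ u) w v`.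
  Δ-nonNeg′ : ∀ N U u v → ∣ U ∣ ℕ.≤ N → u ≢ v → lookup U u ≡ true → lookup U v ≡ true → NonNeg (Δ U u v)
  Δ-nonNeg′ zero U u v ∣U∣≤0 u≢v p q with () ← ℕ.≤-trans (ℕ.≤-reflexive (≡.sym (∣∖∣ U u p))) ∣U∣≤0
  Δ-nonNeg′ (suc N) U u v ∣U∣≤N u≢v p q =
    NonNeg-≋ (Seriesᵣ.sym (Δ-expand U u v u≢v p)) (NonNeg-sum {n} _ summand)
    where
    ∣U∖u∣≤N : ∣ U ∖ u ∣ ℕ.≤ N
    ∣U∖u∣≤N = ℕ.≤-pred (ℕ.≤-trans (ℕ.≤-reflexive (≡.sym (∣∖∣ U u p))) ∣U∣≤N)
    b : Fin n → Bool
    b w = adj G u w ∧ lookup U w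
    summand : ∀ w → NonNeg (when (b w) (F (U ∖ u ∖ w)) ⊛ F (U ∖ u ∖ v)
      ⊟ F (U ∖ u) ⊛ when (adj G u w ∧ lookup (U ∖ v) w) (F (U ∖ u ∖ v ∖ w)))
    summand w with v ≟ w
    ... | yes ≡.refl rewrite lookup-∖-≡ U v | Bool.∧-zeroʳ (adj G u v) | q | Bool.∧-identityʳ (adj G u v) =
      NonNeg-≋ e (NonNeg-when (adj G u v) (λ _ → NonNeg-square (F (U ∖ u ∖ v))))
      where
      e : when (adj G u v) (F (U ∖ u ∖ v) ⊛ F (U ∖ u ∖ v)) ≋ when (adj G u v) (F (U ∖ u ∖ v)) ⊛ F (U ∖ u ∖ v) ⊟ F (U ∖ u) ⊛ 0ₛ
      e = Seriesᵣ.trans (Seriesᵣ.trans (when-* (adj G u v) {F (U ∖ u ∖ v)} {F (U ∖ u ∖ v)}) (⊛-comm (F (U ∖ u ∖ v)) _))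
            (solve 2 (λ a m → a := a :- m :* :0) Seriesᵣ.refl _ (F (U ∖ u)))
    ... | no v≢w rewrite lookup-∖-≢ U v≢w =
      NonNeg-≋ e (NonNeg-when (b w) λ bw → Δ-nonNeg′ N (U ∖ u) w v ∣U∖u∣≤N (v≢w ∘ ≡.sym)
        (w∈U∖u bw) (≡.trans (lookup-∖-≢ U u≢v) q))
      where
      w∈U∖u : b w ≡ true → lookup (U ∖ u) w ≡ true
      w∈U∖u bw with u ≟ w
      ... | yes ≡.refl rewrite irrefl G u with () ← bw
      ... | no u≢w with adj G u w
      ...   | true = ≡.trans (lookup-∖-≢ U u≢w) bw
      e : when (b w) (Δ (U ∖ u) w v) ≋ when (b w) (F (U ∖ u ∖ w)) ⊛ F (U ∖ u ∖ v) ⊟ F (U ∖ u) ⊛ when (b w) (F (U ∖ u ∖ v ∖ w))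
      e with b w
      ... | true = Seriesᵣ.+-congˡ (Seriesᵣ.-‿cong (⊛-cong {F (U ∖ u)} {F (U ∖ u)} Seriesᵣ.refl (F-≡ (∖-comm (U ∖ u) w v))))
      ... | false = solve 2 (λ b m → :0 := :0 :* b :- m :* :0) Seriesᵣ.refl (F (U ∖ u ∖ v)) (F (U ∖ u))

  Δ-nonNeg : ∀ U u v → u ≢ v → lookup U u ≡ true → lookup U v ≡ true → NonNeg (Δ U u v)
  Δ-nonNeg U u v = Δ-nonNeg′ ∣ U ∣ U u v ℕ.≤-refl

-- Multiplicities under vertex deletion: interlacing and essential neighbours.

∧-true : ∀ a {b} → a ∧ b ≡ true → a ≡ true × b ≡ true
∧-true true p = ≡.refl , p

module Multiplicity (ℝ : RealField) (θ : RealField.Carrier ℝ) {n} (G : Graph n) where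
  open RealField ℝ using (Carrier; _≈_; _+_; _*_; -_; 0#; 1#; _≤_; 0≉1)
  open OrderedField ℝ
  open PowerSeries ℝ
  open FiniteSums seriesRing
  open SeriesSums ℝ
  open MatchingSum seriesRing
  open Taylor ℝ θ using (X; pow; weight-X)
  open Rayleigh ℝ G (λ _ → X)
  open Seriesᵣ using () renaming (_-_ to _⊟_)
  module ℝSolver = IntegerCoefficientSolver commutativeRing

  private
    Zₓ : List (Edge n) → Subset n → Series
    Zₓ = Z G (λ _ → X)

  ∂-when : ∀ b {s} → ∂ (when b s) ≋ when b (∂ s)
  ∂-when true k = refl
  ∂-when false k = zeroʳ _

  ∂-⊟ : ∀ s t → ∂ (s ⊟ t) ≋ ∂ s ⊟ ∂ t
  ∂-⊟ s t = Seriesᵣ.trans (∂-⊞ s (Seriesᵣ.- t)) (Seriesᵣ.+-congˡ {∂ s} (∂-neg t))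

  ∂-weight : ∀ {m} (U : Subset m) → ∂ (weight (λ _ → X) U) ≋ sum (λ v → when (lookup U v) (weight (λ _ → X) (U ∖ v)))
  ∂-weight [] = ∂-const 1#
  ∂-weight (false ∷ U) = Seriesᵣ.trans (∂-weight U) (Seriesᵣ.sym (Seriesᵣ.+-identityˡ _))
  ∂-weight {suc m} (true ∷ U) = begin
    ∂ (X ⊛ W)                 ≈⟨ ∂-linear-⊛ θ W ⟩
    W ⊞ X ⊛ ∂ W               ≈⟨ Seriesᵣ.+-congˡ {W} (⊛-cong {X} {X} {∂ W} Seriesᵣ.refl (∂-weight U)) ⟩
    W ⊞ X ⊛ sum f             ≈⟨ Seriesᵣ.+-congˡ {W} (*-distribˡ-sum {m} X f) ⟩
    W ⊞ sum (λ v → X ⊛ f v)   ≈⟨ Seriesᵣ.+-congˡ {W} (sum-cong-≋ (λ v → Seriesᵣ.sym (when-* (lookup U v) {X}))) ⟩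
    W ⊞ sum (λ v → when (lookup U v) (X ⊛ weight (λ _ → X) (U ∖ v))) ∎
    where
    open import Relation.Binary.Reasoning.Setoid Seriesᵣ.setoid
    W = weight (λ _ → X) U
    f : Fin m → Series
    f v = when (lookup U v) (weight (λ _ → X) (U ∖ v))

  -- Differentiating the product over the unmatched vertices removes them one at a time, and a
  -- matching that misses `v` is a matching of `U ∖ v`.
  ∂-Z : ∀ L U → ∂ (Zₓ L U) ≋ sum (λ v → when (lookup U v) (Zₓ L (U ∖ v)))
  ∂-Z [] U = ∂-weight U
  ∂-Z (e ∷ L) U = begin
    ∂ (Zₓ L U ⊟ when o (Zₓ L (U ∖ₑ e)))
      ≈⟨ ∂-⊟ (Zₓ L U) (when o (Zₓ L (U ∖ₑ e))) ⟩
    ∂ (Zₓ L U) ⊟ ∂ (when o (Zₓ L (U ∖ₑ e)))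
      ≈⟨ Seriesᵣ.+-cong (∂-Z L U) (Seriesᵣ.-‿cong (Seriesᵣ.trans (∂-when o) (when-cong o (∂-Z L (U ∖ₑ e))))) ⟩
    sum f ⊟ when o (sum g)
      ≈⟨ Seriesᵣ.+-congˡ {sum f} (Seriesᵣ.-‿cong (sum-when {n} o g)) ⟨
    sum f ⊟ sum (λ v → when o (g v))
      ≈⟨ sum-- {n} f (λ v → when o (g v)) ⟨
    sum (λ v → f v ⊟ when o (g v))
      ≈⟨ sum-cong-≋ {n} (λ v → Seriesᵣ.trans
           (Seriesᵣ.+-congˡ {f v} (Seriesᵣ.-‿cong (when-swap o _ (lookup U v) _ (≡.sym (ok-∖ G U v e)) (Z-≡ G _ L (≡.sym (∖-∖ₑ-comm U v e))))))
           (Seriesᵣ.sym (when-- (lookup U v)))) ⟩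
    sum (λ v → when (lookup U v) (Zₓ L (U ∖ v) ⊟ when (ok G (U ∖ v) e) (Zₓ L (U ∖ v ∖ₑ e)))) ∎
    where
    open import Relation.Binary.Reasoning.Setoid Seriesᵣ.setoid
    o = ok G U e
    f g : Fin n → Series
    f v = when (lookup U v) (Zₓ L (U ∖ v))
    g v = when (lookup (U ∖ₑ e) v) (Zₓ L (U ∖ₑ e ∖ v))

  pow-top : ∀ m j → pow m (m ℕ.+ j) ≈ const 1# j
  pow-top zero j = refl
  pow-top (suc m) j = trans (linear₁-⊛-suc θ (pow m) (m ℕ.+ j)) (trans (+-cong
    (trans (*-congˡ (trans (reflexive (≡.cong (pow m) (≡.sym (ℕ.+-suc m j)))) (pow-top m (suc j)))) (zeroʳ θ)) (pow-top m j))
    (+-identityˡ _))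

  -- In the local parameter, `Z` is monic of degree `∣ U ∣`. The offset `j` also records that higher
  -- coefficients vanish, which the induction needs because `U ∖ₑ e` has degree two less.
  Z-top : ∀ L U j → Zₓ L U (∣ U ∣ ℕ.+ j) ≈ const 1# j
  Z-top [] U j = trans (weight-X U _) (pow-top ∣ U ∣ j)
  Z-top (e ∷ L) U j = trans (+-cong (Z-top L U j) (trans (-‿cong lower) -0#≈0#)) (+-identityʳ _)
    where
    lower : when (ok G U e) (Zₓ L (U ∖ₑ e)) (∣ U ∣ ℕ.+ j) ≈ 0#
    lower with ok G U e in p
    ... | false = refl
    ... | true = trans (reflexive (≡.cong (Zₓ L (U ∖ₑ e)) shift)) (Z-top L (U ∖ₑ e) (suc (suc j)))
      where
      shift : ∣ U ∣ ℕ.+ j ≡ ∣ U ∖ₑ e ∣ ℕ.+ suc (suc j)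
      shift rewrite ∣∖ₑ∣ G U e p | ℕ.+-suc ∣ U ∖ₑ e ∣ (suc j) | ℕ.+-suc ∣ U ∖ₑ e ∣ j = ≡.refl

  F-top : ∀ U → ¬ (F U (∣ U ∣ ℕ.+ 0) ≈ 0#)
  F-top U e = 0≉1 (sym (trans (sym (Z-top (pairs n) U 0)) e))

  abstract
    -- The multiplicity of `θ` for the subgraph on `U`, as an order; the search for it ends because
    -- the polynomial is monic.
    mult : Subset n → ℕ
    mult U = proj₁ (order∃ (F U) _ (F-top U))

    mult-order : ∀ U → HasOrder (F U) (mult U)
    mult-order U = proj₂ (order∃ (F U) _ (F-top U))

  mult-Van : ∀ U {k} → k ℕ.≤ mult U → Van (F U) k
  mult-Van U k≤ = Van-≤ k≤ (proj₁ (mult-order U))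

  Van⇒≤mult : ∀ U {k} → Van (F U) k → k ℕ.≤ mult U
  Van⇒≤mult U v = order≤ v (mult-order U)

  mult-lead : ∀ U {k} → mult U ≡ k → ¬ (F U k ≈ 0#)
  mult-lead U ≡.refl = proj₂ (mult-order U)

  ≉0⇒mult≤ : ∀ U {k} → ¬ (F U k ≈ 0#) → mult U ℕ.≤ k
  ≉0⇒mult≤ U {k} ≉0 with mult U ℕ.≤? k
  ... | yes p = p
  ... | no ¬p = ⊥-elim (≉0 (mult-Van U ℕ.≤-refl k (ℕ.≰⇒> ¬p)))

  Wr : Subset n → Fin n → Series
  Wr U v = ∂ (F U) ⊛ F (U ∖ v) ⊟ F U ⊛ ∂ (F (U ∖ v))

  -- At `w = v` the second guard is false and a square remains when `v` lies in `U`; for any other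
  -- `w` in `U` this is `Δ U w v`.
  Wr-summand : Subset n → Fin n → Fin n → Series
  Wr-summand U v w = when (lookup U w) (F (U ∖ w)) ⊛ F (U ∖ v) ⊟ F U ⊛ when (lookup (U ∖ v) w) (F (U ∖ v ∖ w))

  Wr-expand : ∀ U v → Wr U v ≋ sum (Wr-summand U v)
  Wr-expand U v = begin
    ∂ (F U) ⊛ F (U ∖ v) ⊟ F U ⊛ ∂ (F (U ∖ v))
      ≈⟨ Seriesᵣ.+-cong (⊛-cong {∂ (F U)} {sum f} {F (U ∖ v)} (∂-Z (pairs n) U) Seriesᵣ.refl)
           (Seriesᵣ.-‿cong (⊛-cong {F U} {F U} {∂ (F (U ∖ v))} {sum g} Seriesᵣ.refl (∂-Z (pairs n) (U ∖ v)))) ⟩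
    sum f ⊛ F (U ∖ v) ⊟ F U ⊛ sum g
      ≈⟨ Seriesᵣ.+-cong (*-distribʳ-sum {n} (F (U ∖ v)) f) (Seriesᵣ.-‿cong (*-distribˡ-sum {n} (F U) g)) ⟩
    sum (λ w → f w ⊛ F (U ∖ v)) ⊟ sum (λ w → F U ⊛ g w)
      ≈⟨ sum-- {n} (λ w → f w ⊛ F (U ∖ v)) (λ w → F U ⊛ g w) ⟨
    sum (Wr-summand U v) ∎
    where
    open import Relation.Binary.Reasoning.Setoid Seriesᵣ.setoid
    f g : Fin n → Series
    f w = when (lookup U w) (F (U ∖ w))
    g w = when (lookup (U ∖ v) w) (F (U ∖ v ∖ w))

  Wr-diagonal : ∀ U v → lookup U v ≡ true → F (U ∖ v) ⊛ F (U ∖ v) ≋ Wr-summand U v v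
  Wr-diagonal U v p rewrite p | lookup-∖-≡ U v =
    solve 2 (λ a m → a := a :- m :* :0) Seriesᵣ.refl (F (U ∖ v) ⊛ F (U ∖ v)) (F U)
    where open IntegerCoefficientSolver seriesRing

  Wr-summand-nonNeg : ∀ U v → lookup U v ≡ true → ∀ w → NonNeg (Wr-summand U v w)
  Wr-summand-nonNeg U v p w with v ≟ w
  ... | yes ≡.refl = NonNeg-≋ (Wr-diagonal U v p) (NonNeg-square (F (U ∖ v)))
  ... | no v≢w rewrite lookup-∖-≢ U v≢w = NonNeg-≋ e (NonNeg-when (lookup U w) λ q → Δ-nonNeg U w v (v≢w ∘ ≡.sym) q p)
    where
    open IntegerCoefficientSolver seriesRing
    e : when (lookup U w) (Δ U w v) ≋ when (lookup U w) (F (U ∖ w)) ⊛ F (U ∖ v) ⊟ F U ⊛ when (lookup U w) (F (U ∖ v ∖ w))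
    e with lookup U w
    ... | true = Seriesᵣ.+-congˡ {F (U ∖ w) ⊛ F (U ∖ v)} (Seriesᵣ.-‿cong (⊛-cong {F U} {F U} Seriesᵣ.refl (F-≡ (∖-comm U w v))))
    ... | false = solve 2 (λ b m → :0 := :0 :* b :- m :* :0) Seriesᵣ.refl (F (U ∖ v)) (F U)

  Wr-nonNeg : ∀ U v → lookup U v ≡ true → NonNeg (Wr U v)
  Wr-nonNeg U v p = NonNeg-≋ (Seriesᵣ.sym (Wr-expand U v)) (NonNeg-sum {n} _ (Wr-summand-nonNeg U v p))

  Van-⊛∂ : ∀ {s t m n} → n ℕ.< m → Van s m → Van t n → Van (s ⊛ ∂ t) (n ℕ.+ n)
  Van-⊛∂ {m = m} {zero} n<m vs vt = λ _ ()
  Van-⊛∂ {m = m} {suc n} n<m vs vt = Van-≤ (ℕ.≤-trans (ℕ.≤-reflexive (≡.cong suc (ℕ.+-suc n n))) (ℕ.+-monoˡ-≤ n n<m)) (Van-⊛ m vs (Van-∂ vt))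

  -- With `m` the multiplicity of `U ∖ v`, a drop by two or more would make the Wronskian vanish
  -- beyond order `2m`. Its summands are nonnegative, so the square of `F (U ∖ v)` would vanish
  -- there too, although its order is exactly `2m`.
  mult≤1+mult∖ : ∀ U v → lookup U v ≡ true → mult U ℕ.≤ suc (mult (U ∖ v))
  mult≤1+mult∖ U v p with mult U ℕ.≤? suc (mult (U ∖ v))
  ... | yes q = q
  ... | no ¬q = ⊥-elim (mult-lead (U ∖ v) ≡.refl (a²≈0⇒a≈0 (trans (sym (lead-⊛ m Vm Vm)) (Vsq (m ℕ.+ m) ℕ.≤-refl))))
    where
    m = mult (U ∖ v)
    Vm = mult-Van (U ∖ v) ℕ.≤-refl
    VU : Van (F U) (suc (suc m))
    VU = mult-Van U (ℕ.≰⇒> ¬q)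
    VW : Van (Wr U v) (suc (m ℕ.+ m))
    VW = Van-⊞ (Van-⊛ (suc m) (Van-∂ VU) Vm) (Van-neg (second m VU Vm))
      where
      second : ∀ {s t} m → Van s (suc (suc m)) → Van t m → Van (s ⊛ ∂ t) (suc (m ℕ.+ m))
      second zero vs vt = Van-≤ (ℕ.n≤1+n 1) (Van-⊛ 2 {0} vs (λ _ ()))
      second (suc m) vs vt = Van-≤ (ℕ.≤-reflexive (≡.cong (λ k → suc (suc k)) (ℕ.+-suc m m))) (Van-⊛ (suc (suc (suc m))) vs (Van-∂ vt))
    Vsq : Van (F (U ∖ v) ⊛ F (U ∖ v)) (suc (m ℕ.+ m))
    Vsq = Van-≋ (Seriesᵣ.sym (Wr-diagonal U v p))
      (NonNeg-sum-Van {n} (Wr-summand U v) (Wr-summand-nonNeg U v p) (Van-≋ (Wr-expand U v) VW) v)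

  -- For leading coefficients `a` and `b`, the Wronskian has coefficient `(m+1)ab - mab = ab` at the
  -- even order `2m`, below which it vanishes.
  lead-same-sign : ∀ U v m → lookup U v ≡ true → mult U ≡ suc m → mult (U ∖ v) ≡ m → 0# ≤ F U (suc m) * F (U ∖ v) m
  lead-same-sign U v m p e₁ e₂ = ≤-respʳ-≈ lead (Wr-nonNeg U v p (m ℕ.+ m) (even m)
    (Van-⊞ (Van-⊛ m (Van-∂ VU) Vm) (Van-neg (Van-⊛∂ ℕ.≤-refl VU Vm))))
    where
    open ℝSolver
    VU : Van (F U) (suc m)
    VU = mult-Van U (ℕ.≤-reflexive (≡.sym e₁))
    Vm : Van (F (U ∖ v)) m
    Vm = mult-Van (U ∖ v) (ℕ.≤-reflexive (≡.sym e₂))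
    second : ∀ {s t} m → Van s (suc m) → Van t m → (s ⊛ ∂ t) (m ℕ.+ m) ≈ m · 1# * (s (suc m) * t m)
    second {s} {t} zero vs vt = trans (Van-⊛ {s} {∂ t} 1 {0} vs (λ _ ()) 0 (s≤s z≤n)) (sym (zeroˡ _))
    second {s} {t} (suc m) vs vt = trans (reflexive (≡.cong (s ⊛ ∂ t) (≡.cong suc (ℕ.+-suc m m))))
      (trans (lead-⊛ (suc (suc m)) vs (Van-∂ vt)) (solve 3 (λ a b c → a :* (b :* c) := b :* (a :* c)) refl _ _ _))
    lead : Wr U v (m ℕ.+ m) ≈ F U (suc m) * F (U ∖ v) m
    lead = trans (+-cong (lead-⊛ m (Van-∂ VU) Vm) (-‿cong (second m VU Vm)))
      (trans (solve 4 (λ o k a b → (o :+ k) :* a :* b :- k :* (a :* b) := o :* (a :* b)) refl 1# (m · 1#) _ _) (*-identityˡ _))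

  F-vertex : ∀ U v → lookup U v ≡ true →
    F U ≋ X ⊛ F (U ∖ v) ⊟ sum (λ w → when (adj G v w ∧ lookup U w) (F (U ∖ v ∖ w)))
  F-vertex = Z-vertex G (λ _ → X)

  adjacent-∖ : ∀ U v w → adj G v w ∧ lookup U w ≡ true → lookup (U ∖ v) w ≡ true
  adjacent-∖ U v w b with v ≟ w
  ... | yes ≡.refl rewrite irrefl G v with () ← b
  ... | no v≢w = ≡.trans (lookup-∖-≢ U v≢w) (proj₂ (∧-true (adj G v w) b))

  -- In the expansion at `v`, each neighbour term `U ∖ v ∖ w` has lost at most one against `U ∖ v`,
  -- by `mult≤1+mult∖`, so all terms vanish to the required order.
  mult∖≤1+mult : ∀ U v → lookup U v ≡ true → mult (U ∖ v) ℕ.≤ suc (mult U)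
  mult∖≤1+mult U v p with mult (U ∖ v) in e
  ... | zero = z≤n
  ... | suc m = s≤s (Van⇒≤mult U (Van-≋ (Seriesᵣ.sym (F-vertex U v p)) (Van-⊞
          (Van-≤ (ℕ.≤-trans (ℕ.n≤1+n m) (ℕ.≤-reflexive (≡.sym e))) (Van-⊛ʳ X (mult-Van (U ∖ v) ℕ.≤-refl)))
          (Van-neg (Van-sum {n} _ λ w → Van-when _ λ b → mult-Van (U ∖ v ∖ w)
            (ℕ.≤-pred (ℕ.≤-trans (ℕ.≤-reflexive (≡.sym e)) (mult≤1+mult∖ (U ∖ v) w (adjacent-∖ U v w b)))))))))

  private
    neighbourTerm : Subset n → Fin n → Fin n → Series
    neighbourTerm U a w = when (adj G a w ∧ lookup U w) (F (U ∖ a ∖ w))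

    F-lower : ∀ U a m → lookup U a ≡ true → mult (U ∖ a) ≡ suc m → F U m ≈ - sum (neighbourTerm U a) m
    F-lower U a m p e = trans (F-vertex U a p m)
      (trans (+-congʳ (Van-⊛ʳ X (mult-Van (U ∖ a) (ℕ.≤-reflexive (≡.sym e))) m ℕ.≤-refl)) (+-identityˡ _))

  -- At order `m` the expansion at `a` consists of neighbour terms only. Those essential in `U ∖ a`
  -- agree in sign with its leading coefficient `h`, the others vanish, so a single essential
  -- neighbour keeps the sum from being zero.
  essentialNeighbour⇒mult : ∀ U a w m → lookup U a ≡ true → adj G a w ≡ true → lookup U w ≡ true →
    mult (U ∖ a) ≡ suc m → mult (U ∖ a ∖ w) ≡ m → mult U ≡ m
  essentialNeighbour⇒mult U a w m p aw q e₁ e₂ = ℕ.≤-antisym (≉0⇒mult≤ U FUm≉0)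
    (ℕ.≤-pred (ℕ.≤-trans (ℕ.≤-reflexive (≡.sym e₁)) (mult∖≤1+mult U a p)))
    where
    h = F (U ∖ a) (suc m)
    nonneg : ∀ w → 0# ≤ h * neighbourTerm U a w m
    nonneg w with adj G a w ∧ lookup U w in b
    ... | false = ≤-reflexive (sym (zeroʳ h))
    ... | true with mult (U ∖ a ∖ w) ℕ.≟ m
    ...   | yes e = lead-same-sign (U ∖ a) w m (adjacent-∖ U a w b) e₁ e
    ...   | no ≢m = ≤-reflexive (sym (trans (*-congˡ (mult-Van (U ∖ a ∖ w) ℕ.≤-refl m
              (ℕ.≤∧≢⇒< (ℕ.≤-pred (ℕ.≤-trans (ℕ.≤-reflexive (≡.sym e₁)) (mult≤1+mult∖ (U ∖ a) w (adjacent-∖ U a w b)))) (≢m ∘ ≡.sym)))) (zeroʳ h)))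
    FUm≉0 : ¬ (F U m ≈ 0#)
    FUm≉0 z = *-≉0 (mult-lead (U ∖ a) e₁) (mult-lead (U ∖ a ∖ w) e₂)
      (trans (*-congˡ (reflexive (≡.sym termw))) (sum≈0⇒≈0 {n} h (neighbourTerm U a) m nonneg
        (trans (*-congˡ sum≈0) (zeroʳ h)) w))
      where
      termw : neighbourTerm U a w m ≡ F (U ∖ a ∖ w) m
      termw rewrite aw | q = ≡.refl
      sum≈0 : sum (neighbourTerm U a) m ≈ 0#
      sum≈0 = trans (sym (-‿involutive _)) (trans (-‿cong (trans (sym (F-lower U a m p e₁)) z)) -0#≈0#)

  -- A nonzero coefficient at order `m` must come from some neighbour term, and interlacing makes
  -- the multiplicity of that term exactly `m`.
  mult⇒essentialNeighbour : ∀ U a m → lookup U a ≡ true → mult (U ∖ a) ≡ suc m → mult U ≡ m →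
    ∃[ w ] (adj G a w ≡ true × lookup (U ∖ a) w ≡ true × mult (U ∖ a ∖ w) ≡ m)
  mult⇒essentialNeighbour U a m p e₁ e₂
    with sum≉0⇒∃ {n} (neighbourTerm U a) m (λ z → mult-lead U e₂ (trans (F-lower U a m p e₁) (trans (-‿cong z) -0#≈0#)))
  ... | w , ≉0 with when≉0 (adj G a w ∧ lookup U w) {F (U ∖ a ∖ w)} {m} ≉0
  ...   | b , ≉0′ = w , proj₁ (∧-true _ b) , adjacent-∖ U a w b
    , ℕ.≤-antisym (≉0⇒mult≤ (U ∖ a ∖ w) ≉0′)
        (ℕ.≤-pred (ℕ.≤-trans (ℕ.≤-reflexive (≡.sym e₁)) (mult≤1+mult∖ (U ∖ a) w (adjacent-∖ U a w b))))

  -- In characteristic zero the derivative has order exactly `m`, so one of the vertex deletions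
  -- that sum to it is nonzero at `m`.
  essential∃ : ∀ U m → mult U ≡ suc m → ∃[ v ] (lookup U v ≡ true × mult (U ∖ v) ≡ m)
  essential∃ U m e = v , p , ℕ.≤-antisym (≉0⇒mult≤ (U ∖ v) (proj₂ v∈U))
    (ℕ.≤-pred (ℕ.≤-trans (ℕ.≤-reflexive (≡.sym e)) (mult≤1+mult∖ U v p)))
    where
    f : Fin n → Series
    f v = when (lookup U v) (F (U ∖ v))
    ∂F≉0 : ¬ (∂ (F U) m ≈ 0#)
    ∂F≉0 = *-≉0 (suc·1≉0 m) (mult-lead U e)
    nonzero : ∃[ v ] ¬ (f v m ≈ 0#)
    nonzero = sum≉0⇒∃ {n} f m (λ z → ∂F≉0 (trans (∂-Z (pairs n) U m) z))
    v = proj₁ nonzero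
    v∈U : lookup U v ≡ true × ¬ (F (U ∖ v) m ≈ 0#)
    v∈U = when≉0 (lookup U v) {F (U ∖ v)} {m} (proj₂ nonzero)
    p = proj₁ v∈U

-- Gallai's lemma, and stability of essential vertices when a special vertex is deleted.

module Stability (ℝ : RealField) (θ : RealField.Carrier ℝ) {n} (G : Graph n) where
  open RealField ℝ using (Carrier; _≈_; _+_; _*_; -_; 0#; 1#; _≤_; inverse)
  open OrderedField ℝ
  open PowerSeries ℝ
  open Multiplicity ℝ θ G
  open Taylor ℝ θ using (X)
  open Rayleigh ℝ G (λ _ → X)

  adj⇒≢ : ∀ {u v} → adj G u v ≡ true → u ≢ v
  adj⇒≢ {u} a ≡.refl with () ← ≡.trans (≡.sym a) (irrefl G u)

  -- Otherwise Δ U d a would have odd order.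
  special⇒positive : ∀ U a d → lookup U a ≡ true → lookup U d ≡ true → adj G a d ≡ true →
    mult U ≡ suc (mult (U ∖ d)) → mult U ≢ suc (mult (U ∖ a)) → mult (U ∖ a) ≡ suc (mult U)
  special⇒positive U a d pa pd ad ed ¬ea with mult (U ∖ a) ℕ.≟ suc (mult U)
  ... | yes p = p
  ... | no ≢suc = ⊥-elim (*-≉0 (mult-lead (U ∖ d) ≡.refl) (mult-lead (U ∖ a) ma≡)
          (trans (sym lead) (trans (reflexive (≡.cong (Δ U d a) (ℕ.+-suc k k)))
            (Δ-nonNeg U d a (adj⇒≢ ad ∘ ≡.sym) pd pa (suc (k ℕ.+ k)) (odd k) (≡.subst (Van (Δ U d a)) (ℕ.+-suc k k) van)))))
    where
    k = mult (U ∖ d)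
    -- A drop and a rise are both excluded, so deleting `a` leaves the multiplicity at `suc k`.
    ma≡ : mult (U ∖ a) ≡ suc k
    ma≡ = ℕ.≤-antisym
      (ℕ.≤-trans (ℕ.≤-pred (ℕ.≤∧≢⇒< (mult∖≤1+mult U a pa) ≢suc)) (ℕ.≤-reflexive ed))
      (ℕ.≤-trans (ℕ.≤-reflexive (≡.sym ed))
        (ℕ.≤-pred (ℕ.≤∧≢⇒< (mult≤1+mult∖ U a pa) ¬ea)))
    -- Otherwise `d` would be an essential neighbour of `a` in `U ∖ a`, forcing multiplicity `k` on
    -- `U`.
    mda≢k : mult (U ∖ a ∖ d) ≢ k
    mda≢k e = ℕ.1+n≢n (≡.trans (≡.sym ed) (essentialNeighbour⇒mult U a d k pa ad pd ma≡ e))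
    k<mda : suc k ℕ.≤ mult (U ∖ d ∖ a)
    k<mda = ≡.subst (λ V → suc k ℕ.≤ mult V) (∖-comm U a d) (ℕ.≤∧≢⇒<
      (ℕ.≤-pred (ℕ.≤-trans (ℕ.≤-reflexive (≡.sym ma≡)) (mult≤1+mult∖ (U ∖ a) d (≡.trans (lookup-∖-≢ U (adj⇒≢ ad)) pd))))
      (mda≢k ∘ ≡.sym))
    Vd = mult-Van (U ∖ d) {k} ℕ.≤-refl
    Va = mult-Van (U ∖ a) {suc k} (ℕ.≤-reflexive (≡.sym ma≡))
    V₂ : Van (F U ⊛ F (U ∖ d ∖ a)) (suc k ℕ.+ suc k)
    V₂ = Van-⊛ (suc k) (mult-Van U (ℕ.≤-reflexive (≡.sym ed))) (mult-Van (U ∖ d ∖ a) k<mda)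
    -- The two products in `Δ U d a` have orders `2k+1` and at least `2k+2`, so the first one
    -- decides, at an odd order.
    van : Van (Δ U d a) (k ℕ.+ suc k)
    van = Van-⊞ (Van-⊛ k Vd Va) (Van-neg (Van-≤ (ℕ.n≤1+n _) V₂))
    lead : Δ U d a (k ℕ.+ suc k) ≈ F (U ∖ d) k * F (U ∖ a) (suc k)
    lead = trans (+-cong (lead-⊛ k Vd Va) (trans (-‿cong (V₂ (k ℕ.+ suc k) ℕ.≤-refl)) -0#≈0#)) (+-identityʳ _)

  -- The failure of transitivity in Gallai's lemma: deleting `v` with `d`, or `v` with `d′`, lowers
  -- the multiplicity by at most one, yet deleting `d` with `d′` lowers it by two.
  module _ (H : Subset n) (v d d′ : Fin n) (m : ℕ)
    (v≢d : v ≢ d) (v≢d′ : v ≢ d′) (d≢d′ : d ≢ d′)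
    (pv : lookup H v ≡ true) (pd : lookup H d ≡ true) (pd′ : lookup H d′ ≡ true)
    (mH : mult H ≡ suc (suc m)) (mv : mult (H ∖ v) ≡ suc m) (md : mult (H ∖ d) ≡ suc m) (md′ : mult (H ∖ d′) ≡ suc m)
    (mdd′ : mult (H ∖ d ∖ d′) ≡ m)
    (mdv : suc m ℕ.≤ mult (H ∖ d ∖ v)) (md′v : suc m ℕ.≤ mult (H ∖ d′ ∖ v)) where

    private
      -- Only the weight of `v` changes, by `s` times the local parameter. Of the four series in
      -- `Δ H d d′`, only that of `H` feels this in its leading coefficient, because `F (H ∖ v)` has
      -- order one less; in the other three the correction starts beyond the leading order.
      module Perturbed (s : Carrier) where
        open FiniteSums seriesRing
        open MatchingSum seriesRing
        t : Series
        t = linear 0# s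
        y : Fin n → Series
        y w = X ⊞ when (eqᵇ v w) t
        module Fy = Rayleigh ℝ G y

        t⊛-suc : ∀ f k → (t ⊛ f) (suc k) ≈ s * f k
        t⊛-suc f k = trans (linear-⊛-suc 0# s f k) (trans (+-congʳ (zeroˡ _)) (+-identityˡ _))

        Van-t⊛ : ∀ {f k} → Van f k → Van (t ⊛ f) (suc k)
        Van-t⊛ vf zero _ = zeroˡ _
        Van-t⊛ {f} vf (suc j) (s≤s j<k) = trans (t⊛-suc f j) (trans (*-congˡ (vf j j<k)) (zeroʳ s))

        Fy-expand : ∀ U → lookup U v ≡ true → Fy.F U ≋ F U ⊞ t ⊛ F (U ∖ v)
        Fy-expand U p = Seriesᵣ.trans (Z-perturb G (λ _ → X) y v t (λ w → Seriesᵣ.refl) (pairs n) U)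
          (Seriesᵣ.+-congˡ {F U} (when-≡ p (t ⊛ F (U ∖ v))))

        Van-Fy : ∀ U {k} → lookup U v ≡ true → k ℕ.≤ mult U → k ℕ.≤ suc (mult (U ∖ v)) → Van (Fy.F U) k
        Van-Fy U p k≤ k≤′ = Van-≋ (Seriesᵣ.sym (Fy-expand U p))
          (Van-⊞ (mult-Van U k≤) (Van-≤ k≤′ (Van-t⊛ (mult-Van (U ∖ v) ℕ.≤-refl))))

        lead-Fy : ∀ U {k} → lookup U v ≡ true → k ℕ.≤ mult (U ∖ v) → Fy.F U k ≈ F U k
        lead-Fy U {k} p k≤ = trans (Fy-expand U p k)
          (trans (+-congˡ (Van-t⊛ (mult-Van (U ∖ v) k≤) k ℕ.≤-refl)) (+-identityʳ _))

        vd = ≡.trans (lookup-∖-≢ H (v≢d ∘ ≡.sym)) pv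
        vd′ = ≡.trans (lookup-∖-≢ H (v≢d′ ∘ ≡.sym)) pv
        vdd′ = ≡.trans (lookup-∖-≢ (H ∖ d) (v≢d′ ∘ ≡.sym)) vd

        m≤ : m ℕ.≤ mult (H ∖ d ∖ d′ ∖ v)
        m≤ = ≡.subst (λ V → m ℕ.≤ mult V) (∖-comm (H ∖ d) v d′)
          (ℕ.≤-pred (ℕ.≤-trans mdv (mult≤1+mult∖ (H ∖ d ∖ v) d′
            (≡.trans (lookup-∖-≢ (H ∖ d) v≢d′) (≡.trans (lookup-∖-≢ H d≢d′) pd′)))))

        VA = Van-Fy (H ∖ d) vd (ℕ.≤-reflexive (≡.sym md)) (ℕ.≤-trans mdv (ℕ.n≤1+n _))
        VB = Van-Fy (H ∖ d′) vd′ (ℕ.≤-reflexive (≡.sym md′)) (ℕ.≤-trans md′v (ℕ.n≤1+n _))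
        VC = Van-Fy H pv (ℕ.≤-reflexive (≡.sym mH)) (s≤s (ℕ.≤-reflexive (≡.sym mv)))
        VE = Van-Fy (H ∖ d ∖ d′) vdd′ (ℕ.≤-reflexive (≡.sym mdd′)) (ℕ.≤-trans m≤ (ℕ.n≤1+n _))

        index : suc (suc m) ℕ.+ m ≡ suc m ℕ.+ suc m
        index = ≡.cong suc (≡.sym (ℕ.+-suc m m))

        -- The coefficient of the perturbed `Δ H d d′` at the even order `2m+2`, below which it
        -- vanishes.
        bound : 0# ≤ F (H ∖ d) (suc m) * F (H ∖ d′) (suc m)
                   - (F H (suc (suc m)) + s * F (H ∖ v) (suc m)) * F (H ∖ d ∖ d′) m
        bound = ≤-respʳ-≈
          (+-cong (trans (lead-⊛ (suc m) VA VB) (*-cong (lead-Fy (H ∖ d) vd mdv) (lead-Fy (H ∖ d′) vd′ md′v)))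
            (-‿cong (trans (reflexive (≡.cong (Fy.F H ⊛ Fy.F (H ∖ d ∖ d′)) (≡.sym index))) (trans (lead-⊛ (suc (suc m)) VC VE)
              (*-cong (trans (Fy-expand H pv (suc (suc m))) (+-congˡ (t⊛-suc (F (H ∖ v)) (suc m)))) (lead-Fy (H ∖ d ∖ d′) vdd′ m≤))))))
          (Fy.Δ-nonNeg H d d′ d≢d′ pd pd′ (suc m ℕ.+ suc m) (even (suc m))
            (Van-⊞ (Van-⊛ (suc m) VA VB) (Van-neg (≡.subst (Van (Fy.F H ⊛ Fy.F (H ∖ d ∖ d′))) index (Van-⊛ (suc (suc m)) VC VE)))))

    -- A bound that is affine in the perturbation s and holds for every s has slope 0.
    parallel-transitive : ⊥
    parallel-transitive = 1≰0 (0≤-⇒≤ (≤-respʳ-≈ value (Perturbed.bound s)))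
      where
      open IntegerCoefficientSolver commutativeRing
      hv = F (H ∖ v) (suc m)
      e = F (H ∖ d ∖ d′) m
      h = F H (suc (suc m))
      c = F (H ∖ d) (suc m) * F (H ∖ d′) (suc m)
      inv : ∃[ i ] (hv * e * i ≈ 1#)
      inv = inverse (hv * e) (*-≉0 (mult-lead (H ∖ v) mv) (mult-lead (H ∖ d ∖ d′) mdd′))
      i = proj₁ inv
      -- The solution of `c - (h + s * hv) * e ≈ - 1#`, which contradicts the bound.
      s = (c - h * e + 1#) * i
      value : c - (h + s * hv) * e ≈ 0# - 1#
      value = trans
        (solve 6 (λ c h e v i o → c :- (h :+ (c :- h :* e :+ o) :* i :* v) :* e := c :- h :* e :- (c :- h :* e :+ o) :* (v :* e :* i)) refl c h e hv i 1#)
        (trans (+-congˡ (-‿cong (trans (*-congˡ (proj₂ inv)) (*-identityʳ _))))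
          (solve 2 (λ a o → a :- (a :+ o) := :0 :- o) refl (c - h * e) 1#))

  module _ (U : Subset n) (a d : Fin n) (pa : lookup U a ≡ true) (pd : lookup U d ≡ true) (ad : adj G a d ≡ true)
    (ed : mult U ≡ suc (mult (U ∖ d))) (¬ea : mult U ≢ suc (mult (U ∖ a))) where

    private
      k = mult (U ∖ d)
      mH : mult (U ∖ a) ≡ suc (suc k)
      mH = ≡.trans (special⇒positive U a d pa pd ad ed ¬ea) (≡.cong suc ed)
      ≥k+1 : ∀ v → lookup (U ∖ a) v ≡ true → suc k ℕ.≤ mult (U ∖ a ∖ v)
      ≥k+1 v p = ℕ.≤-pred (ℕ.≤-trans (ℕ.≤-reflexive (≡.sym mH)) (mult≤1+mult∖ (U ∖ a) v p))

    -- `U ∖ v` has multiplicity `k`, so deleting `a` from it gives at most `suc k`; deleting `v`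
    -- from `U ∖ a`, of multiplicity `suc (suc k)`, gives at least that.
    essential⇒essential∖ : ∀ v → lookup (U ∖ a) v ≡ true →
      mult U ≡ suc (mult (U ∖ v)) → mult (U ∖ a) ≡ suc (mult (U ∖ a ∖ v))
    essential⇒essential∖ v p ev = ≡.trans mH (≡.cong suc (ℕ.≤-antisym (≥k+1 v p)
      (≡.subst (λ V → mult V ℕ.≤ suc k) (∖-comm U v a)
        (≡.subst (λ j → mult (U ∖ v ∖ a) ℕ.≤ j) (≡.trans (≡.sym ev) ed)
          (mult∖≤1+mult (U ∖ v) a (≡.trans (lookup-∖-≢ U (lookup-∖⇒≢ U a p ∘ ≡.sym)) pa))))))

    -- Two neighbours `d` and `d′` of `a` together lower `H` by two. By `parallel-transitive`,
    -- unless `v` is one of them, it lowers `H` by two together with one of them. In each case other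
    -- than `v = d`, a neighbour of `a` is then essential in `H ∖ v`, which fixes the multiplicity
    -- of `U ∖ v`.
    essential∖⇒essential : ∀ v → lookup (U ∖ a) v ≡ true →
      mult (U ∖ a) ≡ suc (mult (U ∖ a ∖ v)) → mult U ≡ suc (mult (U ∖ v))
    essential∖⇒essential v p ev = ≡.trans ed (≡.cong suc (≡.sym mU∖v))
      where
      H = U ∖ a
      a≢v : a ≢ v
      a≢v = lookup-∖⇒≢ U a p
      mv : mult (H ∖ v) ≡ suc k
      mv = ℕ.suc-injective (≡.trans (≡.sym ev) mH)
      d∈H : lookup H d ≡ true
      d∈H = ≡.trans (lookup-∖-≢ U (adj⇒≢ ad)) pd
      md : mult (H ∖ d) ≡ suc k
      md = ℕ.suc-injective (≡.trans (≡.sym (essential⇒essential∖ d d∈H ed)) mH)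
      -- Deleting `a` raises the multiplicity of `U ∖ d` from `k` to `suc k`, so `a` has a neighbour
      -- essential in `U ∖ d ∖ a`; this is `d′`.
      neighbour : ∃[ w ] (adj G a w ≡ true × lookup (U ∖ d ∖ a) w ≡ true × mult (U ∖ d ∖ a ∖ w) ≡ k)
      neighbour = mult⇒essentialNeighbour (U ∖ d) a k (≡.trans (lookup-∖-≢ U (adj⇒≢ ad ∘ ≡.sym)) pa)
        (≡.trans (≡.cong mult (∖-comm U d a)) md) ≡.refl
      d′ = proj₁ neighbour
      ad′ = proj₁ (proj₂ neighbour)
      d′∈H∖d : lookup (H ∖ d) d′ ≡ true
      d′∈H∖d = ≡.subst (λ V → lookup V d′ ≡ true) (∖-comm U d a) (proj₁ (proj₂ (proj₂ neighbour)))
      d′∈H = lookup-∖⇒ H d d′∈H∖d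
      mdd′ : mult (H ∖ d ∖ d′) ≡ k
      mdd′ = ≡.trans (≡.cong (λ V → mult (V ∖ d′)) (∖-comm U a d)) (proj₂ (proj₂ (proj₂ neighbour)))
      d≢d′ : d ≢ d′
      d≢d′ = lookup-∖⇒≢ H d d′∈H∖d
      md′d : mult (H ∖ d′ ∖ d) ≡ k
      md′d = ≡.trans (≡.cong mult (∖-comm H d′ d)) mdd′
      md′ : mult (H ∖ d′) ≡ suc k
      md′ = ℕ.≤-antisym
        (ℕ.≤-trans (mult≤1+mult∖ (H ∖ d′) d (≡.trans (lookup-∖-≢ H (d≢d′ ∘ ≡.sym)) d∈H)) (s≤s (ℕ.≤-reflexive md′d)))
        (≥k+1 d′ d′∈H)
      via : ∀ w → adj G a w ≡ true → lookup U w ≡ true → v ≢ w → mult (H ∖ v ∖ w) ≡ k → mult (U ∖ v) ≡ k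
      via w aw pw v≢w e = essentialNeighbour⇒mult (U ∖ v) a w k (≡.trans (lookup-∖-≢ U (a≢v ∘ ≡.sym)) pa) aw
        (≡.trans (lookup-∖-≢ U v≢w) pw)
        (≡.trans (≡.cong mult (∖-comm U v a)) mv) (≡.trans (≡.cong (λ V → mult (V ∖ w)) (∖-comm U v a)) e)
      above : ∀ w → lookup H w ≡ true → v ≢ w → mult (H ∖ v ∖ w) ≢ k → suc k ℕ.≤ mult (H ∖ w ∖ v)
      above w pw v≢w ≢k = ≡.subst (λ V → suc k ℕ.≤ mult V) (∖-comm H v w) (ℕ.≤∧≢⇒<
        (ℕ.≤-pred (ℕ.≤-trans (ℕ.≤-reflexive (≡.sym mv)) (mult≤1+mult∖ (H ∖ v) w (≡.trans (lookup-∖-≢ H v≢w) pw))))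
        (≢k ∘ ≡.sym))
      mU∖v : mult (U ∖ v) ≡ k
      mU∖v with v ≟ d | v ≟ d′
      ... | yes ≡.refl | _ = ≡.refl
      ... | no v≢d | yes v≡d′ = via d ad pd v≢d (≡.trans (≡.cong (λ u → mult (H ∖ u ∖ d)) v≡d′) md′d)
      ... | no v≢d | no v≢d′ with mult (H ∖ v ∖ d) ℕ.≟ k | mult (H ∖ v ∖ d′) ℕ.≟ k
      ...   | yes e | _ = via d ad pd v≢d e
      ...   | no _ | yes e = via d′ ad′ (lookup-∖⇒ U a d′∈H) v≢d′ e
      ...   | no e | no e′ = ⊥-elim (parallel-transitive H v d d′ k v≢d v≢d′ d≢d′ p d∈H d′∈H mH mv md md′ mdd′
                (above d d∈H v≢d e) (above d′ d′∈H v≢d′ e′))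

-- Transfer from `G` to `S` by removing special vertices and putting them back.

-- D is the set of θ-essential vertices of G, S the graph S_θ(G).
module Saturation (ℝ : RealField) (θ : RealField.Carrier ℝ) {n} (G S : Graph n) (A : Subset n) (D : Fin n → Set)
  (A-special : ∀ a → lookup A a ≡ true → ¬ D a × ∃[ d ] (adj G a d ≡ true × D d))
  (S-agree : ∀ i j → lookup A i ≡ false → lookup A j ≡ false → adj G i j ≡ adj S i j)
  (S-join : ∀ a w → lookup A a ≡ true → a ≢ w → adj S a w ≡ true) where

  private
    module MG = Multiplicity ℝ θ G
    module MS = Multiplicity ℝ θ S
  open PowerSeries ℝ
  open MatchingSum seriesRing using (Z-agree)
  open Stability ℝ θ G

  mult-agree : ∀ U → (∀ v → lookup U v ≡ true → lookup A v ≡ false) → MG.mult U ≡ MS.mult U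
  mult-agree U disj = order-unique
    (HasOrder-≋ (Z-agree G S _ (pairs n) U λ i j p q → S-agree i j (disj i p) (disj j q)) (MG.mult-order U))
    (MS.mult-order U)

  -- The list `l` covers the vertices of `A` still in `U`. On the way down they are deleted from
  -- `G`, which keeps `D` as the set of essential vertices and raises the multiplicity; once none is
  -- left the graphs agree. On the way up they are put back in `S`.
  saturate : ∀ (l : List (Fin n)) U k →
    MG.mult U ≡ suc k → (∀ v → D v → lookup U v ≡ true) →
    (∀ v → lookup U v ≡ true → D v ⇔ (MG.mult U ≡ suc (MG.mult (U ∖ v)))) →
    (∀ v → lookup U v ≡ true → lookup A v ≡ true → v ∈ˡ l) →
    MS.mult U ≡ suc k × (∀ v → lookup U v ≡ true → D v ⇔ (MS.mult U ≡ suc (MS.mult (U ∖ v))))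
  saturate [] U k mU D⊆U D⇔ A⊆l =
    ≡.trans (≡.sym (mult-agree U disj)) mU ,
    λ v p → ≡.subst₂ (λ i j → D v ⇔ (i ≡ suc j)) (mult-agree U disj)
      (mult-agree (U ∖ v) (λ w q → disj w (lookup-∖⇒ U v q))) (D⇔ v p)
    where
    disj : ∀ v → lookup U v ≡ true → lookup A v ≡ false
    disj v p with lookup A v in q
    ... | false = ≡.refl
    ... | true with () ← A⊆l v p q
  saturate (a ∷ l) U k mU D⊆U D⇔ A⊆l with lookup U a in pa | lookup A a in qa
  ... | false | _ = saturate l U k mU D⊆U D⇔ λ v p q → drop v p (A⊆l v p q)
    where
    drop : ∀ v → lookup U v ≡ true → v ∈ˡ (a ∷ l) → v ∈ˡ l
    drop v p (there v∈l) = v∈l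
    drop v p (here ≡.refl) with () ← ≡.trans (≡.sym p) pa
  ... | true | false = saturate l U k mU D⊆U D⇔ λ v p q → drop v q (A⊆l v p q)
    where
    drop : ∀ v → lookup A v ≡ true → v ∈ˡ (a ∷ l) → v ∈ˡ l
    drop v q (there v∈l) = v∈l
    drop v q (here ≡.refl) with () ← ≡.trans (≡.sym q) qa
  ... | true | true = mSU , essentialS
    where
    ¬Da = proj₁ (A-special a qa)
    d = proj₁ (proj₂ (A-special a qa))
    ad = proj₁ (proj₂ (proj₂ (A-special a qa)))
    Dd = proj₂ (proj₂ (proj₂ (A-special a qa)))
    a≢d = adj⇒≢ ad
    pd = D⊆U d Dd
    ed : MG.mult U ≡ suc (MG.mult (U ∖ d))
    ed = Equivalence.to (D⇔ d pd) Dd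
    ¬ea : MG.mult U ≢ suc (MG.mult (U ∖ a))
    ¬ea = ¬Da ∘ Equivalence.from (D⇔ a pa)

    IH : MS.mult (U ∖ a) ≡ suc (suc k) ×
         (∀ v → lookup (U ∖ a) v ≡ true → D v ⇔ (MS.mult (U ∖ a) ≡ suc (MS.mult (U ∖ a ∖ v))))
    IH = saturate l (U ∖ a) (suc k)
      (≡.trans (special⇒positive U a d pa pd ad ed ¬ea) (≡.cong suc mU))
      (λ v Dv → ≡.trans (lookup-∖-≢ U (λ { ≡.refl → ¬Da Dv })) (D⊆U v Dv))
      (λ v p → mk⇔
        (λ Dv → essential⇒essential∖ U a d pa pd ad ed ¬ea v p (Equivalence.to (D⇔ v (lookup-∖⇒ U a p)) Dv))
        (λ e → Equivalence.from (D⇔ v (lookup-∖⇒ U a p)) (essential∖⇒essential U a d pa pd ad ed ¬ea v p e)))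
      (λ v p q → drop v p (A⊆l v (lookup-∖⇒ U a p) q))
      where
      drop : ∀ v → lookup (U ∖ a) v ≡ true → v ∈ˡ (a ∷ l) → v ∈ˡ l
      drop v p (there v∈l) = v∈l
      drop v p (here ≡.refl) = ⊥-elim (lookup-∖⇒≢ U a p ≡.refl)

    mSU∖a = proj₁ IH
    essential-∖a : ∀ v → lookup (U ∖ a) v ≡ true → D v → MS.mult (U ∖ a ∖ v) ≡ suc k
    essential-∖a v p Dv = ℕ.suc-injective (≡.trans (≡.sym (Equivalence.to (proj₂ IH v p) Dv)) mSU∖a)

    -- `d` is still a neighbour of `a` in `S` and essential in `U ∖ a`, so restoring `a` lowers the
    -- multiplicity by one.
    mSU : MS.mult U ≡ suc k
    mSU = MS.essentialNeighbour⇒mult U a d (suc k) pa (S-join a d qa a≢d) pd mSU∖a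
      (essential-∖a d (≡.trans (lookup-∖-≢ U a≢d) pd) Dd)

    essentialS : ∀ v → lookup U v ≡ true → D v ⇔ (MS.mult U ≡ suc (MS.mult (U ∖ v)))
    essentialS v p with a ≟ v
    -- Deleting `a` raises the multiplicity in `S`, so `a` is not essential there, in agreement with
    -- `¬Da`.
    ... | yes ≡.refl = mk⇔ (⊥-elim ∘ ¬Da) λ e → ⊥-elim (ℕ.m≢1+n+m (suc k) {1}
            (≡.trans (≡.sym mSU) (≡.trans e (≡.cong suc mSU∖a))))
    ... | no a≢v = mk⇔ to from
      where
      v∈ : lookup (U ∖ a) v ≡ true
      v∈ = ≡.trans (lookup-∖-≢ U a≢v) p
      a∈ : lookup (U ∖ v) a ≡ true
      a∈ = ≡.trans (lookup-∖-≢ U (a≢v ∘ ≡.sym)) pa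
      -- Since a is joined to everything, any essential vertex of U ∖ a ∖ v witnesses that a is positive in U ∖ v.
      to : D v → MS.mult U ≡ suc (MS.mult (U ∖ v))
      to Dv = ≡.trans mSU (≡.cong suc (≡.sym (MS.essentialNeighbour⇒mult (U ∖ v) a w k a∈
        (S-join a w qa (lookup-∖⇒≢ U a w∈U∖a)) (≡.trans (lookup-∖-≢ U (lookup-∖⇒≢ (U ∖ a) v w∈)) (lookup-∖⇒ U a w∈U∖a))
        (≡.trans (≡.cong MS.mult (∖-comm U v a)) (essential-∖a v v∈ Dv))
        (≡.trans (≡.cong (λ V → MS.mult (V ∖ w)) (∖-comm U v a)) (proj₂ (proj₂ witness))))))
        where
        witness : ∃[ w ] (lookup (U ∖ a ∖ v) w ≡ true × MS.mult (U ∖ a ∖ v ∖ w) ≡ k)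
        witness = MS.essential∃ (U ∖ a ∖ v) k (essential-∖a v v∈ Dv)
        w = proj₁ witness
        w∈ = proj₁ (proj₂ witness)
        w∈U∖a = lookup-∖⇒ (U ∖ a) v w∈
      from : MS.mult U ≡ suc (MS.mult (U ∖ v)) → D v
      -- If `v` is essential, `U ∖ v` has multiplicity `k`, so `U ∖ a ∖ v` has at most `suc k`;
      -- interlacing from `U ∖ a` gives at least that.
      from e = Equivalence.from (proj₂ IH v v∈) (≡.trans mSU∖a (≡.cong suc (ℕ.≤-antisym
        (ℕ.≤-pred (≡.subst (ℕ._≤ suc (MS.mult (U ∖ a ∖ v))) mSU∖a (MS.mult≤1+mult∖ (U ∖ a) v v∈)))
        (≡.subst (λ V → MS.mult V ℕ.≤ suc k) (∖-comm U v a)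
          (≡.subst (MS.mult (U ∖ v ∖ a) ℕ.≤_) (≡.trans (≡.sym e) mSU) (MS.mult∖≤1+mult (U ∖ v) a a∈))))))

-- Translation to the definitions of the statement, and the conclusion.

lookup-⊤ : ∀ {n} (v : Fin n) → lookup ⊤ v ≡ true
lookup-⊤ v = Vec.lookup-replicate v true

∁⁅⁆ : ∀ {n} (v : Fin n) → ∁ ⁅ v ⁆ ≡ ⊤ ∖ v
∁⁅⁆ zero = ≡.cong (false ∷_) (∁⊥ _)
  where
  ∁⊥ : ∀ n → ∁ Data.Fin.Subset.⊥ ≡ ⊤ {n}
  ∁⊥ zero = ≡.refl
  ∁⊥ (suc n) = ≡.cong (true ∷_) (∁⊥ n)
∁⁅⁆ (suc v) = ≡.cong (true ∷_) (∁⁅⁆ v)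

module _ (ℝ : RealField) (θ : RealField.Carrier ℝ) {n} (G : Graph n) where
  open PowerSeries ℝ
  open Multiplicity ℝ θ G
  open Taylor ℝ θ
  open GE ℝ using (IsMult; μ[_,_]; Essential)

  IsMult⇒mult : ∀ U k → IsMult θ μ[ G , U ] k → mult U ≡ k
  IsMult⇒mult U k i = order-unique (mult-order U) (HasOrder-≋ (taylor-μ G U) (IsMult⇒HasOrder k μ[ G , U ] i))

  mult⇒IsMult : ∀ U {k} → mult U ≡ k → IsMult θ μ[ G , U ] k
  mult⇒IsMult U ≡.refl = HasOrder⇒IsMult (mult U) μ[ G , U ] (HasOrder-≋ (Seriesᵣ.sym (taylor-μ G U)) (mult-order U))

  -- Multiplicities are unique, so the witness `k` of essentiality can only be `mult (⊤ ∖ v)`.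
  Essential⇔ : ∀ v → Essential θ G v ⇔ (mult ⊤ ≡ suc (mult (⊤ ∖ v)))
  Essential⇔ v = mk⇔
    (λ { (k , i , j) → ≡.trans (IsMult⇒mult ⊤ (suc k) i)
           (≡.cong suc (≡.trans (≡.sym (IsMult⇒mult (∁ ⁅ v ⁆) k j)) (≡.cong mult (∁⁅⁆ v)))) })
    (λ e → mult (⊤ ∖ v) , mult⇒IsMult ⊤ e , mult⇒IsMult (∁ ⁅ v ⁆) (≡.cong mult (∁⁅⁆ v)))

theorem1p9 : (ℝ : RealField) → (θ : RealField.Carrier ℝ) → (n : ℕ) → (G : Graph n) →
    (A : Subset n) → (∀ v → (v ∈ A) ⇔ GE.Special ℝ θ G v) →
    GE.SameGE ℝ θ G (GE.S-graph ℝ G A)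
theorem1p9 ℝ θ n G A A⇔ = ⤖-id (Fin n) ,
  (λ v → mk⇔ (Special⇒ v) (⇒Special v)) ,
  (λ u v ¬su ¬sv → S-agree u v (∉A u ¬su) (∉A v ¬sv))
  where
  open GE ℝ using (Special; Essential; S-graph)
  S = S-graph G A
  module MG = Multiplicity ℝ θ G
  module MS = Multiplicity ℝ θ S

  ∈A : ∀ v → lookup A v ≡ true → Special θ G v
  ∈A v p = Equivalence.to (A⇔ v) (Vec.lookup⇒[]= v A p)

  ∉A : ∀ v → ¬ Special θ G v → lookup A v ≡ false
  ∉A v ¬s with lookup A v in p
  ... | true = ⊥-elim (¬s (∈A v p))
  ... | false = ≡.refl

  S-agree : ∀ i j → lookup A i ≡ false → lookup A j ≡ false → adj G i j ≡ adj S i j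
  S-agree i j p q rewrite p | q with i ≟ j
  ... | yes ≡.refl = irrefl G i
  ... | no _ = ≡.sym (Bool.∨-identityʳ _)

  S-join : ∀ a w → lookup A a ≡ true → a ≢ w → adj S a w ≡ true
  S-join a w p a≢w rewrite p | eqᵇ-≢ a≢w = Bool.∨-zeroʳ _

  S-edge : ∀ i j → adj G i j ≡ true → adj S i j ≡ true
  S-edge i j p with i ≟ j
  ... | yes ≡.refl with () ← ≡.trans (≡.sym p) (irrefl G i)
  S-edge i j p | no _ rewrite p = ≡.refl

  D : Fin n → Set
  D v = MG.mult ⊤ ≡ suc (MG.mult (⊤ ∖ v))

  A-special : ∀ a → lookup A a ≡ true → ¬ D a × ∃[ d ] (adj G a d ≡ true × D d)
  A-special a p with ∈A a p
  ... | ¬ess , d , ad , ess = ¬ess ∘ Equivalence.from (Essential⇔ ℝ θ G a) , d , ad , Equivalence.to (Essential⇔ ℝ θ G d) ess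

  open Saturation ℝ θ G S A D A-special S-agree S-join

  -- An essential vertex makes the multiplicity positive, as `saturate` requires. With no essential
  -- vertex there is no special one, so `A` is empty and the graphs agree.
  D⇔S : ∀ v → D v ⇔ (MS.mult ⊤ ≡ suc (MS.mult (⊤ ∖ v)))
  D⇔S v with any? (λ u → MG.mult ⊤ ℕ.≟ suc (MG.mult (⊤ ∖ u)))
  ... | yes (d , Dd) = proj₂ (saturate (allFin n) ⊤ (MG.mult (⊤ ∖ d)) Dd (λ u _ → lookup-⊤ u) (λ u _ → mk⇔ id id)
          (λ u _ _ → ∈-allFin u)) v (lookup-⊤ v)
  ... | no ¬D = ≡.subst₂ (λ i j → D v ⇔ (i ≡ suc j)) (mult-agree ⊤ λ u _ → empty u) (mult-agree (⊤ ∖ v) λ u _ → empty u) (mk⇔ id id)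
    where
    empty : ∀ u → lookup A u ≡ false
    empty u = ∉A u λ s → ¬D (proj₁ (proj₂ s) , Equivalence.to (Essential⇔ ℝ θ G _) (proj₂ (proj₂ (proj₂ s))))

  essential⇒ : ∀ v → Essential θ G v → Essential θ S v
  essential⇒ v = Equivalence.from (Essential⇔ ℝ θ S v) ∘ Equivalence.to (D⇔S v) ∘ Equivalence.to (Essential⇔ ℝ θ G v)

  ⇒essential : ∀ v → Essential θ S v → Essential θ G v
  ⇒essential v = Equivalence.from (Essential⇔ ℝ θ G v) ∘ Equivalence.from (D⇔S v) ∘ Equivalence.to (Essential⇔ ℝ θ S v)

  Special⇒ : ∀ v → Special θ G v → Special θ S v
  Special⇒ v (¬ess , w , vw , ess) = ¬ess ∘ ⇒essential v , w , S-edge v w vw , essential⇒ w ess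

  -- Let `v` lie outside `A`. Its neighbour `w`, essential in `S`, is essential in `G` and hence
  -- outside `A` too, so the edge between them was already in `G`.
  ⇒Special : ∀ v → Special θ S v → Special θ G v
  ⇒Special v (¬ess , w , vw , ess) = choose (lookup A v) ≡.refl
    where
    choose : ∀ b → lookup A v ≡ b → Special θ G v
    choose true p = ∈A v p
    choose false p = ¬ess ∘ essential⇒ v , w ,
      ≡.trans (S-agree v w p (∉A w λ s → proj₁ s (⇒essential w ess))) vw , ⇒essential w ess
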